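{- $\#\mathrm{para}_{\beta}\text{ - }\mathrm{L}\subseteq \mathrm{FFPT}$.
   Context: Inputs are pairs $(x,k)$ with $x\in\{0,1\}^*$ and parameter $k\in\mathbb N$; a parameterised function is a function $F:\{0,1\}^*\times\mathbb N\to\mathbb N$. Machines are TMs with random access to the input. A nondeterministic TM is a deterministic TM with an additional read-only choice tape (not counted for space); a nondeterministic step is one in which the choice-tape head moves to a previously unvisited cell; $\#\mathrm{acc}_M(x,k)$ is the number of accepting computation paths of $M$ on $(x,k)$. A $\mathrm{para}\text{ - }\mathrm{L}$-machine uses space $O(\log|x|+f(k))$ on input $(x,k)$ for some computable $f$. A nondeterministic machine is $k$-bounded if for some computable $f$ it reads at most $f(k)\cdot\log|x|$ choice-tape bits on every input $(x,k)$; it has read-once access if its choice-tape head moves only one way. $\#\mathrm{para}_{\beta}\text{ - }\mathrm{L}$ is the class of parameterised functions $F$ for which there is a $k$-bounded nondeterministic $\mathrm{para}\text{ - }\mathrm{L}$-machine $M$ with read-once access to its nondeterministic bits such that $\#\mathrm{acc}_M(x,k)=F(x,k)$ for all $(x,k)$. $\mathrm{FFPT}$ is the class of functions computable by deterministic TMs with output in time $f(k)\cdot p(|x|)$ for a computable $f$ and a polynomial $p$. -}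

module Defs where

open import Data.Bool using (Bool; _∧_; T)
open import Data.Digit using (Bit; fromDigits; toDigits)
open import Data.Fin using (Fin)
open import Data.List using (List; []; _∷_; [_]; _++_; _∷ʳ_; _ʳ++_; map; head; drop; length; foldr)
open import Data.List.Membership.Propositional using (_∈_)
open import Data.List.Relation.Unary.Any using (Any)
open import Data.Maybe using (Maybe; nothing; just; is-nothing)
open import Data.Nat using (ℕ; zero; suc; _+_; _*_; _≤_; _<_)
open import Data.Nat.Logarithm using (⌈log₂_⌉)
open import Data.Product using (Σ; ∃; _×_; _,_; proj₁)
open import Data.Unit using (⊤; tt)
open import Data.Vec as Vec using (Vec; []; _∷_)
open import Function.Bundles using (_↔_)
open import Relation.Binary.Construct.Closure.ReflexiveTransitive using (Star)
open import Relation.Binary.PropositionalEquality using (_≡_; _≢_)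
open import Relation.Unary using (Pred)

Instance : Set
Instance = List Bit × ℕ

ParamFunction : Set
ParamFunction = Instance → ℕ

-- The binary numeral without superfluous zeros, least significant bit first.
binary : ℕ → List Bit
binary n = proj₁ (toDigits 2 n)

------------------------------------------------------------------------
-- Computable functions: total μ-recursive functions

data Rec : ℕ → Set where
  zeroᴿ : ∀ {n} → Rec n
  sucᴿ  : Rec 1
  projᴿ : ∀ {n} → Fin n → Rec n
  compᴿ : ∀ {m n} → Rec m → Vec (Rec n) m → Rec n
  precᴿ : ∀ {n} → Rec n → Rec (suc (suc n)) → Rec (suc n)
  μᴿ    : ∀ {n} → Rec (suc n) → Rec n

-- Eval e xs y: the partial function denoted by e is defined at xs, with value y.
data Eval : ∀ {n} → Rec n → Vec ℕ n → ℕ → Set where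
  zeroᴱ  : ∀ {n} {xs : Vec ℕ n} → Eval zeroᴿ xs 0
  sucᴱ   : ∀ {x} → Eval sucᴿ (x ∷ []) (suc x)
  projᴱ  : ∀ {n} {xs : Vec ℕ n} i → Eval (projᴿ i) xs (Vec.lookup xs i)
  compᴱ  : ∀ {m n} {e : Rec m} {es : Vec (Rec n) m} {xs} (ys : Vec ℕ m) {z} →
           (∀ i → Eval (Vec.lookup es i) xs (Vec.lookup ys i)) →
           Eval e ys z → Eval (compᴿ e es) xs z
  prec₀ᴱ : ∀ {n} {e : Rec n} {s : Rec (suc (suc n))} {xs y} →
           Eval e xs y → Eval (precᴿ e s) (0 ∷ xs) y
  precₛᴱ : ∀ {n} {e : Rec n} {s : Rec (suc (suc n))} {xs m y z} →
           Eval (precᴿ e s) (m ∷ xs) y → Eval s (m ∷ y ∷ xs) z →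
           Eval (precᴿ e s) (suc m ∷ xs) z
  μᴱ     : ∀ {n} {e : Rec (suc n)} {xs m} →
           Eval e (m ∷ xs) 0 →
           (∀ i → i < m → ∃ λ y → Eval e (i ∷ xs) (suc y)) →
           Eval (μᴿ e) xs m

Computable : (ℕ → ℕ) → Set
Computable f = Σ (Rec 1) λ e → ∀ n → Eval e (n ∷ []) (f n)

------------------------------------------------------------------------
-- Tapes

data Move : Set where
  left stay right : Move

-- A one-way infinite tape, of which only the visited cells are stored;
-- the cells left of the head are listed nearest first, and `nothing` is blank.
record Tape (A : Set) : Set where
  constructor tape
  field
    before  : List (Maybe A)
    current : Maybe A
    after   : List (Maybe A)

open Tape

module _ {A : Set} where

  blankTape : Tape A
  blankTape = tape [] nothing []

  move : Move → Tape A → Tape A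
  move left  (tape []       a rs)       = tape [] a rs
  move left  (tape (l ∷ ls) a rs)       = tape ls l (a ∷ rs)
  move stay  t                          = t
  move right (tape ls       a [])       = tape (a ∷ ls) nothing []
  move right (tape ls       a (r ∷ rs)) = tape (a ∷ ls) r rs

  writeMove : Maybe A × Move → Tape A → Tape A
  writeMove (a , m) t = move m (record t { current = a })

  size : Tape A → ℕ
  size t = length (before t) + suc (length (after t))

  -- All visited cells, starting from the left end of the tape.
  cells : Tape A → List (Maybe A)
  cells t = before t ʳ++ current t ∷ after t

  upToBlank : List (Maybe A) → List A
  upToBlank (just a ∷ as) = a ∷ upToBlank as
  upToBlank _             = []

------------------------------------------------------------------------
-- Turing machines with random access to the input

data InputSymbol : Set where
  bit       : Bit → InputSymbol
  separator : InputSymbol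

inputWord : Instance → List InputSymbol
inputWord (x , k) = map bit x ++ separator ∷ map bit (binary k)

Finite : Set → Set
Finite A = ∃ λ n → A ↔ Fin n

record Action (State Symbol Write : Set) (tapes : ℕ) : Set where
  field
    next    : State
    address : Maybe Bit × Move
    work    : Vec (Maybe Symbol × Move) tapes
    extra   : Write

-- A deterministic machine with an address tape and several work tapes. In each
-- step it sees the input symbol at the position whose binary representation is
-- on the address tape (`nothing` if that position is beyond the end of the
-- input). Read and Write describe its interaction with one further tape (a
-- choice tape or an output tape). The machine halts where δ is `nothing`.
record Machine (Read Write : Set) : Set₁ where
  field
    State        : Set
    Symbol       : Set
    finiteState  : Finite State
    finiteSymbol : Finite Symbol
    tapes        : ℕ
    start        : State
    δ            : State → (input : Maybe InputSymbol) (address : Maybe Bit) →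
                   (work : Vec (Maybe Symbol) tapes) → Read →
                   Maybe (Action State Symbol Write tapes)

module _ {Read Write : Set} (M : Machine Read Write) where
  open Machine M

  record Core : Set where
    constructor core
    field
      state   : State
      address : Tape Bit
      work    : Vec (Tape Symbol) tapes

  initialCore : Core
  initialCore = core start blankTape (Vec.replicate tapes blankTape)

  scannedInput : Instance → Core → Maybe InputSymbol
  scannedInput i c =
    head (drop (fromDigits (upToBlank (cells (Core.address c)))) (inputWord i))

  action : Instance → Core → Read → Maybe (Action State Symbol Write tapes)
  action i c = δ (Core.state c) (scannedInput i c) (current (Core.address c))
                 (Vec.map current (Core.work c))

  perform : Action State Symbol Write tapes → Core → Core
  perform a c = core (Action.next a)
                     (writeMove (Action.address a) (Core.address c))
                     (Vec.zipWith writeMove (Action.work a) (Core.work c))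

  space : Core → ℕ
  space c = size (Core.address c) + Vec.sum (Vec.map size (Core.work c))

------------------------------------------------------------------------
-- Nondeterministic machines

-- The visited part of the choice tape. The head starts on an end marker to the
-- left of the first choice bit; `behind` lists the choice bits from the scanned
-- cell back to the marker, `ahead` the visited ones to the right of the head.
record ChoiceTape : Set where
  constructor choices
  field
    behind : List Bit
    ahead  : List Bit

open ChoiceTape

bitsRead : ChoiceTape → ℕ
bitsRead t = length (behind t) + length (ahead t)

-- The possible results of a move; there are two exactly when the head
-- enters a previously unvisited cell.
moveChoice : Move → ChoiceTape → List ChoiceTape
moveChoice left  (choices []       as)       = [ choices [] as ]
moveChoice left  (choices (b ∷ bs) as)       = [ choices bs (b ∷ as) ]
moveChoice stay  t                           = [ t ]
moveChoice right (choices bs       (a ∷ as)) = [ choices (a ∷ bs) as ]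
moveChoice right (choices bs       [])       =
  choices (Fin.zero ∷ bs) [] ∷ choices (Fin.suc Fin.zero ∷ bs) [] ∷ []

record NTM : Set₁ where
  field
    machine   : Machine (Maybe Bit) Move
    accepting : Machine.State machine → Bool

module _ (N : NTM) where
  open NTM N
  open Machine machine

  record NConfig : Set where
    constructor nconfig
    field
      base   : Core machine
      choice : ChoiceTape

  open NConfig

  initialN : NConfig
  initialN = nconfig (initialCore machine) (choices [] [])

  module _ (i : Instance) where

    actionN : NConfig → Maybe (Action State Symbol Move tapes)
    actionN c = action machine i (base c) (head (behind (choice c)))

    successors : NConfig → List NConfig
    successors c with actionN c
    ... | nothing = []
    ... | just a  = map (nconfig (perform machine a (base c)))
                        (moveChoice (Action.extra a) (choice c))

    accepts : NConfig → Bool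
    accepts c = is-nothing (actionN c) ∧ accepting (Core.state (base c))

    -- The computation paths from c that end in an accepting halting
    -- configuration; the position in `successors` records the choice made.
    data AcceptingPath (c : NConfig) : Set where
      accept : T (accepts c) → AcceptingPath c
      step   : Any AcceptingPath (successors c) → AcceptingPath c

    Reachable : NConfig → Set
    Reachable = Star (λ c d → d ∈ successors c) initialN

  #acc≡ : Instance → ℕ → Set
  #acc≡ i n = AcceptingPath i initialN ↔ Fin n

  ParaL : Set
  ParaL = Σ (ℕ → ℕ) λ f → Computable f × ∃ λ a → ∀ x k c → Reachable (x , k) c →
          space machine (base c) ≤ a * (⌈log₂ length x ⌉ + f k)

  KBounded : Set
  KBounded = Σ (ℕ → ℕ) λ f → Computable f × (∀ x k c → Reachable (x , k) c →
             bitsRead (choice c) ≤ f k * ⌈log₂ length x ⌉)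

  ReadOnce : Set
  ReadOnce = ∀ q s b w r {a} → δ q s b w r ≡ just a → Action.extra a ≢ left

#paraβ-L : Pred ParamFunction _
#paraβ-L F = Σ NTM λ N → ParaL N × KBounded N × ReadOnce N × (∀ i → #acc≡ N i (F i))

------------------------------------------------------------------------
-- Deterministic machines with output

-- In each step the machine may append one bit to its write-only output tape.
DTM : Set₁
DTM = Machine ⊤ (Maybe Bit)

emit : Maybe Bit → List Bit → List Bit
emit nothing  o = o
emit (just b) o = o ∷ʳ b

module _ (M : DTM) where

  record DConfig : Set where
    constructor dconfig
    field
      base   : Core M
      output : List Bit

  open DConfig

  initialD : DConfig
  initialD = dconfig (initialCore M) []

  stepD : Instance → DConfig → Maybe DConfig
  stepD i c with action M i (base c) tt
  ... | nothing = nothing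
  ... | just a  = just (dconfig (perform M a (base c)) (emit (Action.extra a) (output c)))

  -- HaltsIn i c t o: started in c, M halts after exactly t steps with output o.
  data HaltsIn (i : Instance) (c : DConfig) : ℕ → List Bit → Set where
    halt : stepD i c ≡ nothing → HaltsIn i c 0 (output c)
    step : ∀ {d t o} → stepD i c ≡ just d → HaltsIn i d t o → HaltsIn i c (suc t) o

-- Coefficients are listed from the constant term upwards.
evalPoly : List ℕ → ℕ → ℕ
evalPoly p n = foldr (λ a r → a + n * r) 0 p

FFPT : Pred ParamFunction _
FFPT F = Σ DTM λ M → Σ (ℕ → ℕ) λ f → Computable f × ∃ λ p → ∀ x k → ∃ λ t →
         HaltsIn M (x , k) (initialD M) t (binary (F (x , k))) × t ≤ f k * evalPoly p (length x)

{-# OPTIONS --safe #-}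
module Submission where

-- A configuration of the nondeterministic machine N is determined, up to its
-- future, by its state, its last choice bit and the contents of its tapes, so by
-- a string of length O(log|x| + f(k)); there are at most g(k)·poly(|x|) of them.
-- A depth-first search over this configuration graph computes the number of
-- accepting paths from every reachable configuration once and keeps it in a
-- table. Since N reads a bounded number of choice bits, a configuration that is
-- met while it is still being expanded lies on a deterministic cycle and has no
-- accepting path, so the provisional value 0 it has in the table is correct. The
-- search never needs f itself: it stops when the reachable part is exhausted.

open import Defs
open import Data.Bool using (Bool; true; false; if_then_else_; _∨_; _∧_; T)
open import Data.Bool.Properties using (∨-identityʳ; ∨-zeroʳ)
open import Data.Digit using (Bit; fromDigits; toDigits)
open import Data.Empty using (⊥-elim)
open import Data.Fin using (Fin; zero; suc; toℕ)
open import Data.Fin.Permutation using (↔⇒≡)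
open import Data.Fin.Properties using (_≟_; injective⇒≤; 0↔⊥; 1↔⊤; 2↔Bool; +↔⊎; *↔×)
open import Data.List using (List; []; _∷_; _++_; _∷ʳ_; _ʳ++_; map; head; drop; foldl; foldr; length; lookup; allFin; cartesianProduct; cartesianProductWith)
open import Data.List.Membership.Propositional using (_∈_; _∉_)
open import Data.List.Membership.Propositional.Properties using (∈-map⁺; ∈-cartesianProductWith⁺; ∈-cartesianProduct⁺; ∈-allFin; ∈-lookup)
open import Data.List.Properties using (∷-injectiveʳ; ++-assoc; ++-identityʳ; ++-ʳ++; ʳ++-defn; ʳ++-ʳ++; map-ʳ++; length-map; length-++; length-ʳ++)
open import Data.List.Relation.Unary.All as All using (All; []; _∷_)
open import Data.List.Relation.Unary.AllPairs using (AllPairs; []; _∷_)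
open import Data.List.Relation.Unary.Any as Any using (Any; here; there)
open import Data.List.Relation.Unary.Any.Properties using (⊥↔Any[]; ∷↔; lookup-index)
open import Data.List.Relation.Unary.Unique.Propositional using (Unique)
open import Data.Maybe as Maybe using (Maybe; nothing; just; is-nothing; maybe′)
open import Data.Nat hiding (_≟_)
open import Data.Nat.DivMod using (_divMod_; result)
open import Data.Nat.Induction using (<′-Rec; Acc; acc)
open import Data.Nat.Logarithm using (⌈log₂_⌉; ⌈log₂⌉-mono-≤; ⌈log₂2^n⌉≡n)
open import Data.Nat.Properties hiding (_≟_)
open import Data.Nat.Solver using (module +-*-Solver)
open import Data.Product using (∃; _×_; _,_; proj₁; proj₂)
open import Data.Product.Function.NonDependent.Propositional using (_×-↔_)
open import Data.Sum using (_⊎_; inj₁; inj₂)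
open import Data.Sum.Function.Propositional using (_⊎-↔_)
open import Data.Unit using (⊤; tt)
open import Data.Vec as Vec using (Vec; []; _∷_)
import Data.Vec.Properties as Vec
open import Function.Base using (_∘_; case_of_)
open import Function.Bundles using (_↔_; mk↔ₛ′; Inverse)
open import Function.Construct.Composition using (_↔-∘_)
open import Function.Construct.Identity using (↔-id)
open import Function.Construct.Symmetry using (↔-sym)
open import Function.Properties.Inverse using (↔⇒↣)
import Induction.WellFounded as WF
open import Level using (0ℓ)
open import Relation.Binary.Construct.Closure.ReflexiveTransitive using (Star; ε; _◅_; _◅◅_)
open import Relation.Binary.Definitions using (DecidableEquality)
open import Relation.Binary.PropositionalEquality using (_≡_; _≢_; refl; sym; trans; cong; cong₂; subst; subst₂)
open import Relation.Nullary using (yes; no; does; ¬_; contradiction)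
open import Relation.Nullary.Decidable using (via-injection)
open import Relation.Unary using (_⊆_)

-- Binary numerals

-- A string of columns forgets how many choice bits have been read. The bound on that number comes
-- back through one argument: a cycle with a nondeterministic step could be repeated until the bound
-- is exceeded. The stored counts may be large numbers, so their length has to be controlled too.
-- This is done by counting additions: each one lengthens its longer summand by at most one bit.
-- With `X` bounding the number of configurations, there are at most `2 X` iterations, each
-- performing additions linear in `X`. So a single bound `W`, quadratic in `X`, covers the number of
-- table entries and the length of keys and values alike. An iteration costs time quadratic in `W`,
-- which explains the fifth power of `X` in the running time. All data live on stacks, so nothing is
-- updated in place. This dictates the form of the search: entries are only ever added to the table,
-- and lookups sweep through all of it.

data Pos : List Bit → Set where
  one : Pos (suc zero ∷ [])
  _∷_ : ∀ b {bs} → Pos bs → Pos (b ∷ bs)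

Expands : ℕ → Set
Expands n = ∃ λ (ds : List Bit) → fromDigits ds ≡ n

-- The implication is wrapped in a data type so that unification can read `n` and `e` off the type
-- `PosIf n e`.
data PosIf n (e : Expands n) : Set where
  posIf : (0 < n → Pos (proj₁ e)) → PosIf n e

posIf⁻¹ : ∀ {n e} → PosIf n e → 0 < n → Pos (proj₁ e)
posIf⁻¹ (posIf p) = p

-- The recursion inside toDigits is on a local function that cannot be named, and
-- which depends on the argument of toDigits. Below, the recursor is abstracted to
-- a variable w, so that unification can recover that function from the goal: it
-- is the solution of the _ in the types of helper-pos₀ and helper-pos₁.
RecBuilder : Set₁
RecBuilder = (P : ℕ → Set) → (∀ n → <′-Rec P n → P n) → ∀ n → Acc _<′_ n → <′-Rec P n

data IsBuilder : RecBuilder → Set₁ where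
  isBuilder : IsBuilder WF.Some.wfRecBuilder

rec-ind : {P : ℕ → Set} {f : ∀ n → <′-Rec P n → P n} (Q : ∀ n → P n → Set) →
  (∀ n (rec : <′-Rec P n) → (∀ {m} (m<n : m <′ n) → Q m (rec m<n)) → Q n (f n rec)) →
  ∀ {w : RecBuilder} → IsBuilder w →
  ∀ {n} {a : Acc _<′_ n} {m} {m<n : m <′ n} → Q m (w P f n a m<n)
rec-ind {P} {f} Q h isBuilder {n} {a} = go n a
  where
  go : ∀ n (a : Acc _<′_ n) {m} {m<n : m <′ n} → Q m (WF.Some.wfRecBuilder P f n a m<n)
  go n (acc rs) {m} {m<n} = h m _ (λ k<m → go m (rs m<n))

mutual
  binary-pos : ∀ n → 0 < n → Pos (binary n)
  binary-pos n 0<n with n divMod 2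
  ... | result zero zero refl = case 0<n of λ ()
  ... | result zero (suc zero) eq = one
  ... | result (suc x) r refl with suc x divMod 2 | WF.Some.wfRecBuilder {_<_ = _<′_} {ℓ = 0ℓ} | isBuilder
  ... | result zero (suc zero) eq | _ | w = r ∷ one
  ... | result (suc y) zero refl | _ | w = r ∷ (zero ∷ posIf⁻¹ (rec-ind PosIf (helper-pos₀ r y) w) (s≤s z≤n))
  ... | result (suc y) (suc zero) refl | _ | w = r ∷ (suc zero ∷ posIf⁻¹ (rec-ind PosIf (helper-pos₁ r y) w) (s≤s z≤n))

  helper-pos₀ : ∀ (r : Bit) (y : ℕ) n (rec : <′-Rec Expands n) →
    (∀ {m} (m<n : m <′ n) → PosIf m (rec m<n)) → PosIf n _
  helper-pos₀ r y n rec ih with n divMod 2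
  ... | result zero zero refl = posIf λ ()
  ... | result zero (suc zero) eq = posIf λ _ → one
  ... | result (suc x) r refl = posIf λ _ → r ∷ posIf⁻¹ (ih _) (s≤s z≤n)

  helper-pos₁ : ∀ (r : Bit) (y : ℕ) n (rec : <′-Rec Expands n) →
    (∀ {m} (m<n : m <′ n) → PosIf m (rec m<n)) → PosIf n _
  helper-pos₁ r y n rec ih with n divMod 2
  ... | result zero zero refl = posIf λ ()
  ... | result zero (suc zero) eq = posIf λ _ → one
  ... | result (suc x) r refl = posIf λ _ → r ∷ posIf⁻¹ (ih _) (s≤s z≤n)

pos>0 : ∀ {bs} → Pos bs → 0 < fromDigits bs
pos>0 one = s≤s z≤n
pos>0 (_∷_ zero {bs} p) with fromDigits bs | pos>0 p
... | suc n | _ = s≤s z≤n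
pos>0 (suc zero ∷ p) = s≤s z≤n

one-injective : ∀ {cs} → Pos cs → 1 ≡ fromDigits cs → suc zero ∷ [] ≡ cs
one-injective one e = refl
one-injective (_∷_ zero {cs} q) e with fromDigits cs
... | zero  = case e of λ ()
... | suc n = case e of λ ()
one-injective (_∷_ (suc zero) {cs} q) e with fromDigits cs | pos>0 q
... | suc n | _ = case e of λ ()

-- Parity settles the lowest digit; the leading one demanded by `Pos` excludes padding with zeros,
-- which would leave the value unchanged.
digits-injective : ∀ {bs cs} → Pos bs → Pos cs → fromDigits bs ≡ fromDigits cs → bs ≡ cs
digits-injective one q e = one-injective q e
digits-injective (b ∷ p) one e = sym (one-injective (b ∷ p) (sym e))
digits-injective (b ∷ p) (c ∷ q) e with split b c e
  where
  split : ∀ (b c : Bit) {m n} → toℕ b + m * 2 ≡ toℕ c + n * 2 → b ≡ c × m ≡ n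
  split zero       zero       e = refl , *-cancelʳ-≡ _ _ 2 e
  split (suc zero) (suc zero) e = refl , *-cancelʳ-≡ _ _ 2 (suc-injective e)
  split zero       (suc zero) {m} {n} e = ⊥-elim (even≢odd m n (trans (*-comm 2 m) (trans e (cong suc (*-comm n 2)))))
  split (suc zero) zero       {m} {n} e = ⊥-elim (even≢odd n m (trans (*-comm 2 n) (trans (sym e) (cong suc (*-comm m 2)))))
... | refl , m≡n = cong (b ∷_) (digits-injective p q m≡n)

-- Zero is the empty string, so that a table entry can be opened without writing a bit. Its numeral
-- `binary 0` is a single digit instead, which `outputBits` supplies.
data Canonical : List Bit → Set where
  []  : Canonical []
  pos : ∀ {bs} → Pos bs → Canonical bs

outputBits : List Bit → List Bit
outputBits []         = zero ∷ []
outputBits bs@(_ ∷ _) = bs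

outputBits-binary : ∀ {bs} → Canonical bs → outputBits bs ≡ binary (fromDigits bs)
outputBits-binary []                = refl
outputBits-binary {b ∷ bs} (pos p) = digits-injective p
  (binary-pos _ (pos>0 p)) (sym (proj₂ (toDigits 2 (fromDigits (b ∷ bs)))))

carryBit : Bool → ℕ
carryBit false = 0
carryBit true  = 1

addBit : Bool → Bit → Bit → Bit × Bool
addBit false zero       zero       = zero , false
addBit false zero       (suc zero) = suc zero , false
addBit false (suc zero) zero       = suc zero , false
addBit false (suc zero) (suc zero) = zero , true
addBit true  zero       zero       = suc zero , false
addBit true  zero       (suc zero) = zero , true
addBit true  (suc zero) zero       = zero , true
addBit true  (suc zero) (suc zero) = suc zero , true

addBit-correct : ∀ c b b′ → let r , c′ = addBit c b b′ in
  toℕ r + carryBit c′ * 2 ≡ carryBit c + (toℕ b + toℕ b′)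
addBit-correct false zero       zero       = refl
addBit-correct false zero       (suc zero) = refl
addBit-correct false (suc zero) zero       = refl
addBit-correct false (suc zero) (suc zero) = refl
addBit-correct true  zero       zero       = refl
addBit-correct true  zero       (suc zero) = refl
addBit-correct true  (suc zero) zero       = refl
addBit-correct true  (suc zero) (suc zero) = refl

carryBits : Bool → List Bit
carryBits false = []
carryBits true  = suc zero ∷ []

addBits : Bool → List Bit → List Bit → List Bit
addBits c     []       []         = carryBits c
addBits c     []       (b′ ∷ bs′) = let r , c′ = addBit c zero b′ in r ∷ addBits c′ [] bs′
addBits c     (b ∷ bs) []         = let r , c′ = addBit c b zero in r ∷ addBits c′ bs []
addBits c     (b ∷ bs) (b′ ∷ bs′) = let r , c′ = addBit c b b′ in r ∷ addBits c′ bs bs′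

addBits-correct : ∀ c bs bs′ → fromDigits (addBits c bs bs′) ≡ carryBit c + (fromDigits bs + fromDigits bs′)
addBits-correct = go
  where
  digit : ∀ c b b′ m n → let r , c′ = addBit c b b′ in
    toℕ r + (carryBit c′ + (m + n)) * 2 ≡ carryBit c + (toℕ b + m * 2 + (toℕ b′ + n * 2))
  digit c b b′ m n = let r , c′ = addBit c b b′ in trans
    (solve 4 (λ r k m n → r :+ (k :+ (m :+ n)) :* con 2 := (r :+ k :* con 2) :+ (m :+ n) :* con 2)
       refl (toℕ r) (carryBit c′) m n)
    (trans (cong (_+ (m + n) * 2) (addBit-correct c b b′))
    (solve 5 (λ c x y m n → (c :+ (x :+ y)) :+ (m :+ n) :* con 2 := c :+ (x :+ m :* con 2 :+ (y :+ n :* con 2)))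
       refl (carryBit c) (toℕ b) (toℕ b′) m n))
    where open +-*-Solver

  go : ∀ c bs bs′ → fromDigits (addBits c bs bs′) ≡ carryBit c + (fromDigits bs + fromDigits bs′)
  go false []       []         = refl
  go true  []       []         = refl
  go c     []       (b′ ∷ bs′) rewrite go (proj₂ (addBit c zero b′)) [] bs′ = digit c zero b′ 0 (fromDigits bs′)
  go c     (b ∷ bs) []         rewrite go (proj₂ (addBit c b zero)) bs [] = digit c b zero (fromDigits bs) 0
  go c     (b ∷ bs) (b′ ∷ bs′) rewrite go (proj₂ (addBit c b b′)) bs bs′ = digit c b b′ (fromDigits bs) (fromDigits bs′)

addBits-length : ∀ c bs bs′ → length (addBits c bs bs′) ≤ suc (length bs ⊔ length bs′)
addBits-length false []       []         = z≤n
addBits-length true  []       []         = s≤s z≤n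
addBits-length c     []       (b′ ∷ bs′) = s≤s (addBits-length _ [] bs′)
addBits-length c     (b ∷ bs) []         = s≤s (≤-trans (addBits-length _ bs []) (s≤s (≤-reflexive (⊔-identityʳ _))))
addBits-length c     (b ∷ bs) (b′ ∷ bs′) = s≤s (addBits-length _ bs bs′)

addBits-pos : ∀ c {bs bs′} → Canonical bs → Canonical bs′ → Pos bs ⊎ Pos bs′ → Pos (addBits c bs bs′)
addBits-pos c []  []  (inj₁ ())
addBits-pos c []  []  (inj₂ ())
addBits-pos c []  (pos p) _ = fromRight c p
  where
  fromRight : ∀ c {bs} → Pos bs → Pos (addBits c [] bs)
  fromRight false one     = one
  fromRight true  one     = zero ∷ one
  fromRight c     (b ∷ p) = _ ∷ fromRight _ p
addBits-pos c (pos p) []  _ = fromLeft c p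
  where
  fromLeft : ∀ c {bs} → Pos bs → Pos (addBits c bs [])
  fromLeft false one     = one
  fromLeft true  one     = zero ∷ one
  fromLeft c     (b ∷ p) = _ ∷ fromLeft _ p
addBits-pos false (pos one)     (pos one)     _ = zero ∷ one
addBits-pos true  (pos one)     (pos one)     _ = suc zero ∷ one
addBits-pos c     (pos one)     (pos (b ∷ q)) _ = _ ∷ addBits-pos _ [] (pos q) (inj₂ q)
addBits-pos c     (pos (b ∷ p)) (pos one)     _ = _ ∷ addBits-pos _ (pos p) [] (inj₁ p)
addBits-pos c     (pos (b ∷ p)) (pos (_ ∷ q)) _ = _ ∷ addBits-pos _ (pos p) (pos q) (inj₁ p)

addBits-canonical : ∀ {bs bs′} → Canonical bs → Canonical bs′ → Canonical (addBits false bs bs′)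
addBits-canonical []      []      = []
addBits-canonical []      (pos q) = pos (addBits-pos false [] (pos q) (inj₂ q))
addBits-canonical (pos p) q       = pos (addBits-pos false (pos p) q (inj₁ p))

-- Finite types

finite-↔ : ∀ {A B} → A ↔ B → Finite B → Finite A
finite-↔ i (n , j) = n , j ↔-∘ i

finite-Fin : ∀ {n} → Finite (Fin n)
finite-Fin = _ , ↔-id _

finite-⊤ : Finite ⊤
finite-⊤ = 1 , ↔-sym 1↔⊤

finite-Bool : Finite Bool
finite-Bool = 2 , ↔-sym 2↔Bool

finite-⊎ : ∀ {A B} → Finite A → Finite B → Finite (A ⊎ B)
finite-⊎ (m , i) (n , j) = m + n , ↔-sym +↔⊎ ↔-∘ (i ⊎-↔ j)

finite-× : ∀ {A B} → Finite A → Finite B → Finite (A × B)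
finite-× (m , i) (n , j) = m * n , ↔-sym *↔× ↔-∘ (i ×-↔ j)

finite-Maybe : ∀ {A} → Finite A → Finite (Maybe A)
finite-Maybe fin = finite-↔
  (mk↔ₛ′ (λ { nothing → inj₁ tt ; (just a) → inj₂ a }) (λ { (inj₁ _) → nothing ; (inj₂ a) → just a })
         (λ { (inj₁ _) → refl ; (inj₂ _) → refl }) (λ { nothing → refl ; (just _) → refl }))
  (finite-⊎ finite-⊤ fin)

finite-Vec : ∀ {A} n → Finite A → Finite (Vec A n)
finite-Vec zero fin = finite-↔
  (mk↔ₛ′ (λ _ → tt) (λ _ → []) (λ _ → refl) (λ { [] → refl })) finite-⊤
finite-Vec (suc n) fin = finite-↔
  (mk↔ₛ′ (λ { (a ∷ v) → a , v }) (λ { (a , v) → a ∷ v }) (λ { (_ , _) → refl }) (λ { (_ ∷ _) → refl }))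
  (finite-× fin (finite-Vec n fin))

finite-InputSymbol : Finite InputSymbol
finite-InputSymbol = finite-↔
  (mk↔ₛ′ (λ { (bit b) → inj₁ b ; separator → inj₂ tt }) (λ { (inj₁ b) → bit b ; (inj₂ _) → separator })
         (λ { (inj₁ _) → refl ; (inj₂ _) → refl }) (λ { (bit _) → refl ; separator → refl }))
  (finite-⊎ finite-Fin finite-⊤)

-- Stack machines

data StackOp (A : Set) : Set where
  keep pop : StackOp A
  push     : A → StackOp A

apply : ∀ {A} → StackOp A → List A → List A
apply keep     xs       = xs
apply pop      []       = []
apply pop      (x ∷ xs) = xs
apply (push x) xs       = x ∷ xs

record StackAction (Control Symbol : Set) (stacks : ℕ) : Set where
  constructor act
  field
    next  : Control
    addr  : StackOp (Maybe Bit)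
    ops   : Vec (StackOp Symbol) stacks
    write : Maybe Bit

-- The search touches each of its stores at one end only, so it is written for stacks, where neither
-- head positions nor leftovers on a tape have to be described. The address tape becomes a stack
-- whose top is hidden from `δ`; it may contain blanks, since the address tape of N may.
record StackMachine : Set₁ where
  field
    Control       : Set
    Symbol        : Set
    finiteControl : Finite Control
    finiteSymbol  : Finite Symbol
    stacks        : ℕ
    start         : Control
    δ             : Control → Maybe InputSymbol → Vec (Maybe Symbol) stacks →
                    Maybe (StackAction Control Symbol stacks)

symbolAt : Instance → List (Maybe Bit) → Maybe InputSymbol
symbolAt i as = head (drop (fromDigits (upToBlank as)) (inputWord i))

module Stack (M : StackMachine) where
  open StackMachine M

  record Config : Set where
    constructor config
    field
      control : Control
      addr    : List (Maybe Bit)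
      heap    : Vec (List Symbol) stacks
      output  : List Bit

  open Config public

  act-on : Config → StackAction Control Symbol stacks → Config
  act-on c (act q a ops w) = config q (apply a (addr c)) (Vec.zipWith apply ops (heap c)) (emit w (output c))

  choose : Instance → Config → Maybe (StackAction Control Symbol stacks)
  choose i c = δ (control c) (symbolAt i (addr c ʳ++ [])) (Vec.map head (heap c))

  -- The number in brackets is only an upper bound on the number of steps.
  data _⊢_⟶[_]_ (i : Instance) (c : Config) : ℕ → Config → Set where
    done : ∀ {n} → i ⊢ c ⟶[ n ] c
    step : ∀ {n a d} → choose i c ≡ just a → i ⊢ act-on c a ⟶[ n ] d → i ⊢ c ⟶[ suc n ] d

  weaken : ∀ {i c d m n} → m ≤ n → i ⊢ c ⟶[ m ] d → i ⊢ c ⟶[ n ] d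
  weaken m≤n       done       = done
  weaken (s≤s m≤n) (step e r) = step e (weaken m≤n r)

  infixr 5 _▷_
  _▷_ : ∀ {i c d e m n} → i ⊢ c ⟶[ m ] d → i ⊢ d ⟶[ n ] e → i ⊢ c ⟶[ m + n ] e
  done     ▷ r = weaken (m≤n+m _ _) r
  step e q ▷ r = step e (q ▷ r)

  one-step : ∀ {i c a} → choose i c ≡ just a → i ⊢ c ⟶[ 1 ] act-on c a
  one-step e = step e done

  ends : ∀ {i c d d′ n} → d ≡ d′ → i ⊢ c ⟶[ n ] d → i ⊢ c ⟶[ n ] d′
  ends refl r = r

  initial : Config
  initial = config start [] (Vec.replicate stacks []) []

  -- Every step of the stack machine takes two steps: the first one moves the
  -- heads, the second one writes the pushed symbols and blanks the address cell.
  Pending : Set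
  Pending = Vec (Maybe Symbol) stacks

  moving : StackOp Symbol → Maybe Symbol → Maybe Symbol × Move
  moving keep     a = a , stay
  moving pop      a = a , left
  moving (push _) a = a , right

  pushed : StackOp Symbol → Maybe Symbol
  pushed (push x) = just x
  pushed _        = nothing

  writing : Maybe Symbol → Maybe Symbol → Maybe Symbol × Move
  writing nothing  a = a , stay
  writing (just x) _ = just x , stay

  movingAddr : StackOp (Maybe Bit) → Maybe Bit × Move
  movingAddr keep     = nothing , stay
  movingAddr pop      = nothing , left
  movingAddr (push a) = a , right

  firstHalf : Vec (Maybe Symbol) stacks → StackAction Control Symbol stacks →
              Action (Control × Maybe Pending) Symbol (Maybe Bit) stacks
  firstHalf tops (act q a ops w) = record
    { next = q , just (Vec.map pushed ops) ; address = movingAddr a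
    ; work = Vec.zipWith moving ops tops ; extra = w }

  secondHalf : Control → Vec (Maybe Symbol) stacks → Pending → Action (Control × Maybe Pending) Symbol (Maybe Bit) stacks
  secondHalf q tops p = record
    { next = q , nothing ; address = nothing , stay
    ; work = Vec.zipWith writing p tops ; extra = nothing }

  δ′ : Control × Maybe Pending → Maybe InputSymbol → Maybe Bit → Vec (Maybe Symbol) stacks → ⊤ →
       Maybe (Action (Control × Maybe Pending) Symbol (Maybe Bit) stacks)
  δ′ (q , nothing) r _ tops _ = Maybe.map (firstHalf tops) (δ q r tops)
  δ′ (q , just p)  _ _ tops _ = just (secondHalf q tops p)

  machine : DTM
  machine = record
    { State = Control × Maybe Pending ; Symbol = Symbol
    ; finiteState = finite-× finiteControl (finite-Maybe (finite-Vec stacks (finite-Maybe finiteSymbol)))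
    ; finiteSymbol = finiteSymbol
    ; tapes = stacks ; start = start , nothing ; δ = δ′ }

  -- The bottom of a stack is a blank at the left end of the tape; whatever lies
  -- to the right of the top is garbage.
  stackTape : List Symbol → List (Maybe Symbol) → Tape Symbol
  stackTape []       rs = tape [] nothing rs
  stackTape (x ∷ xs) rs = tape (map just xs ∷ʳ nothing) (just x) rs

  realise : Config → List (Maybe Bit) → Vec (List (Maybe Symbol)) stacks → DConfig machine
  realise (config q as xss o) r rs =
    dconfig (core (q , nothing) (tape as nothing r) (Vec.zipWith stackTape xss rs)) o

  current-stackTape : ∀ xs rs → Tape.current (stackTape xs rs) ≡ head xs
  current-stackTape []       rs = refl
  current-stackTape (x ∷ xs) rs = refl

  currents : ∀ {n} (xss : Vec (List Symbol) n) rss →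
    Vec.map Tape.current (Vec.zipWith stackTape xss rss) ≡ Vec.map head xss
  currents []         []         = refl
  currents (xs ∷ xss) (rs ∷ rss) = cong₂ _∷_ (current-stackTape xs rs) (currents xss rss)

  write² : Maybe Symbol → Tape Symbol → Tape Symbol
  write² p t = writeMove (writing p (Tape.current t)) t

  move¹ : StackOp Symbol → Tape Symbol → Tape Symbol
  move¹ op t = writeMove (moving op (Tape.current t)) t

  -- A Turing machine writes before it moves, so the cell for a pushed symbol is reached only by the
  -- first step and filled by the second, whatever garbage it held. A pop erases nothing: the
  -- removed symbol stays behind to the right of the head. At the bottom of the stack the move to
  -- the left has no effect.
  operate : ∀ op xs rs → ∃ λ rs′ →
    write² (pushed op) (move¹ op (stackTape xs rs)) ≡ stackTape (apply op xs) rs′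
  operate keep     []           rs       = rs , refl
  operate keep     (x ∷ xs)     rs       = rs , refl
  operate pop      []           rs       = rs , refl
  operate pop      (x ∷ [])     rs       = just x ∷ rs , refl
  operate pop      (x ∷ y ∷ xs) rs       = just x ∷ rs , refl
  operate (push y) []           []       = [] , refl
  operate (push y) (x ∷ xs)     []       = [] , refl
  operate (push y) []           (r ∷ rs) = rs , refl
  operate (push y) (x ∷ xs)     (r ∷ rs) = rs , refl

  operateAll : ∀ {n} (ops : Vec (StackOp Symbol) n) xss rss → ∃ λ rss′ →
    let ts = Vec.zipWith stackTape xss rss
        us = Vec.zipWith writeMove (Vec.zipWith moving ops (Vec.map Tape.current ts)) ts in
    Vec.zipWith writeMove (Vec.zipWith writing (Vec.map pushed ops) (Vec.map Tape.current us)) us ≡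
    Vec.zipWith stackTape (Vec.zipWith apply ops xss) rss′
  operateAll []         []         []         = [] , refl
  operateAll (op ∷ ops) (xs ∷ xss) (rs ∷ rss) =
    let rs′ , e = operate op xs rs ; rss′ , es = operateAll ops xss rss in
    rs′ ∷ rss′ , cong₂ _∷_ e es

  operateAddr : ∀ (op : StackOp (Maybe Bit)) as rs → ∃ λ rs′ →
    writeMove (nothing , stay) (writeMove (movingAddr op) (tape as nothing rs)) ≡ tape (apply op as) nothing rs′
  operateAddr keep     as       rs       = rs , refl
  operateAddr pop      []       rs       = rs , refl
  operateAddr pop      (a ∷ as) rs       = nothing ∷ rs , refl
  operateAddr (push a) as       []       = [] , refl
  operateAddr (push a) as       (r ∷ rs) = rs , refl

  -- The address head rests on a blank after every simulated step, and an address ends at its first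
  -- blank. Hence the garbage beyond the head never becomes part of the address.
  upToBlank-ʳ++ : ∀ (as rs : List (Maybe Bit)) → upToBlank (as ʳ++ nothing ∷ rs) ≡ upToBlank (as ʳ++ [])
  upToBlank-ʳ++ as rs = trans (cong upToBlank (eq as)) (cut (as ʳ++ []) rs)
    where
    eq : ∀ as {bs : List (Maybe Bit)} → as ʳ++ bs ≡ (as ʳ++ []) ++ bs
    eq as = trans (ʳ++-defn as) (cong (_++ _) (sym (trans (ʳ++-defn as) (++-identityʳ _))))
    cut : ∀ (as rs : List (Maybe Bit)) → upToBlank (as ++ nothing ∷ rs) ≡ upToBlank as
    cut []             rs = refl
    cut (nothing ∷ as) rs = refl
    cut (just a ∷ as)  rs = cong (a ∷_) (cut as rs)

  module _ (i : Instance) where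

    action-realise : ∀ c r rs → action machine i (DConfig.base (realise c r rs)) tt ≡
                     Maybe.map (firstHalf (Vec.map head (heap c))) (choose i c)
    action-realise (config q as xss o) r rs
      rewrite upToBlank-ʳ++ as r | currents xss rs = refl

    two-steps : ∀ c r rs {a} → choose i c ≡ just a → ∃ λ r′ → ∃ λ rs′ → ∃ λ d →
      stepD machine i (realise c r rs) ≡ just d × stepD machine i d ≡ just (realise (act-on c a) r′ rs′)
    two-steps c@(config q as xss o) r rs {a} e with action machine i (DConfig.base (realise c r rs)) tt | action-realise c r rs
    ... | _ | refl rewrite e =
      let r′  , er = operateAddr (StackAction.addr a) as r
          rs′ , es = operateAll (StackAction.ops a) xss rs in
      r′ , rs′ , _ , refl ,
      cong₂ (λ t ws → just (dconfig (core (StackAction.next a , nothing) t ws) (emit (StackAction.write a) o))) er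
        (trans (cong after (sym (currents xss rs))) es)
      where
      ts = Vec.zipWith stackTape xss rs

      after : Vec (Maybe Symbol) stacks → Vec (Tape Symbol) stacks
      after v = let us = Vec.zipWith writeMove (Vec.zipWith moving (StackAction.ops a) v) ts in
        Vec.zipWith writeMove (Vec.zipWith writing (Vec.map pushed (StackAction.ops a)) (Vec.map Tape.current us)) us

    halts : ∀ {n c d} r rs → i ⊢ c ⟶[ n ] d → choose i d ≡ nothing →
      ∃ λ t → HaltsIn machine i (realise c r rs) t (output d) × t ≤ n + n
    halts {c = c} r rs done e = 0 , halt stuck , z≤n
      where
      stuck : stepD machine i (realise c r rs) ≡ nothing
      stuck with action machine i (DConfig.base (realise c r rs)) tt | action-realise c r rs
      ... | _ | refl rewrite e = refl
    halts {n = suc n} r rs (step e₁ run) e =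
      let r′ , rs′ , _ , p , q = two-steps _ r rs e₁
          t , h , t≤ = halts r′ rs′ run e in
      2 + t , step p (step q h) , s≤s (≤-trans (s≤s t≤) (≤-reflexive (sym (+-suc n n))))

    run-initial : ∀ {n d} → i ⊢ initial ⟶[ n ] d → choose i d ≡ nothing →
      ∃ λ t → HaltsIn machine i (initialD machine) t (output d) × t ≤ n + n
    run-initial run e = subst (λ ts → ∃ λ t → HaltsIn machine i (dconfig (core (start , nothing) blankTape ts) []) t _ × t ≤ _)
      (replicates stacks) (halts [] (Vec.replicate stacks []) run e)
      where
      replicates : ∀ n → Vec.zipWith stackTape (Vec.replicate n []) (Vec.replicate n []) ≡ Vec.replicate n blankTape
      replicates zero    = refl
      replicates (suc n) = cong (_ ∷_) (replicates n)

-- Tapes as sequences of tracks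

finite-≟ : ∀ {A} → Finite A → DecidableEquality A
finite-≟ (_ , i) = via-injection (↔⇒↣ i) _≟_

nth : ∀ {A : Set} → A → List A → ℕ → A
nth d []       p       = d
nth d (x ∷ xs) zero    = x
nth d (x ∷ xs) (suc p) = nth d xs p

nth-map : ∀ {A B : Set} (f : A → B) d xs p → nth (f d) (map f xs) p ≡ f (nth d xs p)
nth-map f d []       p       = refl
nth-map f d (x ∷ xs) zero    = refl
nth-map f d (x ∷ xs) (suc p) = nth-map f d xs p

nth-≥ : ∀ {A : Set} d (xs : List A) p → length xs ≤ p → nth d xs p ≡ d
nth-≥ d []       p       _       = refl
nth-≥ d (x ∷ xs) (suc p) (s≤s l) = nth-≥ d xs p l

nth-ʳ++ : ∀ {A : Set} d (ls : List A) {xs ys} p → (∀ p → nth d xs p ≡ nth d ys p) →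
  nth d (ls ʳ++ xs) p ≡ nth d (ls ʳ++ ys) p
nth-ʳ++ d []       p h = h p
nth-ʳ++ d (l ∷ ls) p h = nth-ʳ++ d ls p λ { zero → refl ; (suc p) → h p }

nth-ʳ++-≥ : ∀ {A : Set} d (ls : List A) {xs} p → nth d (ls ʳ++ xs) (length ls + p) ≡ nth d xs p
nth-ʳ++-≥ d []            p = refl
nth-ʳ++-≥ d (l ∷ ls) {xs} p =
  trans (cong (nth d (ls ʳ++ l ∷ xs)) (sym (+-suc (length ls) p))) (nth-ʳ++-≥ d ls (suc p))

nth-ʳ++-≢ : ∀ {A : Set} d (ls : List A) {xs ys} k {p} → p ≢ k + length ls →
  (∀ p → p ≢ k → nth d xs p ≡ nth d ys p) → nth d (ls ʳ++ xs) p ≡ nth d (ls ʳ++ ys) p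
nth-ʳ++-≢ d []       k p≢ h = h _ (p≢ ∘ λ e → trans e (sym (+-identityʳ k)))
nth-ʳ++-≢ d (l ∷ ls) k p≢ h = nth-ʳ++-≢ d ls (suc k) (p≢ ∘ λ e → trans e (sym (+-suc k _)))
  λ { zero _ → refl ; (suc p) p≢k → h p (p≢k ∘ cong suc) }

nth-ʳ++-set : ∀ {A : Set} d (ls : List A) a b {rs} p →
  nth d (ls ʳ++ b ∷ rs) p ≡ (if p ≡ᵇ length ls then b else nth d (ls ʳ++ a ∷ rs) p)
nth-ʳ++-set d ls a b p with p ≡ᵇ length ls in e
... | true  = trans (cong (nth d (ls ʳ++ b ∷ _)) (trans (≡ᵇ⇒≡ p _ (subst T (sym e) tt)) (sym (+-identityʳ _)))) (nth-ʳ++-≥ d ls 0)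
... | false = nth-ʳ++-≢ d ls 0 (λ p≡ → subst T e (≡⇒≡ᵇ p _ p≡)) λ { zero p≢ → contradiction refl p≢ ; (suc p) _ → refl }

Track : Set → Set
Track A = Maybe A × Bool

blankTrack : ∀ {A} → Track A
blankTrack = nothing , false

track : ∀ {A} → Tape A → ℕ → Track A
track t p = nth nothing (cells t) p , (p ≡ᵇ length (Tape.before t))

previous : ∀ {A : Set} → (ℕ → A) → ℕ → Maybe A
previous F zero    = nothing
previous F (suc p) = just (F p)

-- Whether the head is in the middle cell after the move; `nothing` as left
-- neighbour stands for the left end of the tape.
arrives : ∀ {A} → Move → Maybe (Track A) → Track A → Track A → Bool
arrives stay  _        c r = proj₂ c
arrives right nothing  c r = false
arrives right (just l) c r = proj₂ l
arrives left  nothing  c r = proj₂ c ∨ proj₂ r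
arrives left  (just _) c r = proj₂ r

newTrack : ∀ {A} → Maybe A × Move → Maybe (Track A) → Track A → Track A → Track A
newTrack (b , m) l c r = (if proj₂ c then b else proj₁ c) , arrives m l c r

newTrack-blank : ∀ {A} (w : Maybe A × Move) → newTrack w (just blankTrack) blankTrack blankTrack ≡ blankTrack
newTrack-blank (b , left)  = refl
newTrack-blank (b , stay)  = refl
newTrack-blank (b , right) = refl

-- The new state of a cell depends only on the cell and its two neighbours; this locality is what
-- lets a configuration be rewritten in a single sweep.
newTrack-correct : ∀ {A} (w : Maybe A × Move) (t : Tape A) p →
  newTrack w (previous (track t) p) (track t p) (track t (suc p)) ≡ track (writeMove w t) p
newTrack-correct (b , m) t p = cong₂ _,_ (sym (content m t)) (place m t p)
  where
  content : ∀ m t → nth nothing (cells (writeMove (b , m) t)) p ≡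
            (if p ≡ᵇ length (Tape.before t) then b else nth nothing (cells t) p)
  content left  (tape []       a rs)       = nth-ʳ++-set nothing [] a b p
  content left  (tape (l ∷ ls) a rs)       = nth-ʳ++-set nothing (l ∷ ls) a b p
  content stay  (tape ls       a rs)       = nth-ʳ++-set nothing ls a b p
  content right (tape ls       a (r ∷ rs)) = nth-ʳ++-set nothing ls a b p
  content right (tape ls       a [])       = trans
    (nth-ʳ++ nothing ls p λ { zero → refl ; (suc zero) → refl ; (suc (suc p)) → refl })
    (nth-ʳ++-set nothing ls a b p)

  place : ∀ m t p → arrives m (previous (track t) p) (track t p) (track t (suc p)) ≡
          (p ≡ᵇ length (Tape.before (writeMove (b , m) t)))
  place left  (tape []       a rs)       zero    = refl
  place left  (tape []       a rs)       (suc p) = refl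
  place left  (tape (l ∷ ls) a rs)       zero    = refl
  place left  (tape (l ∷ ls) a rs)       (suc p) = refl
  place stay  t                          p       = refl
  place right (tape ls       a [])       zero    = refl
  place right (tape ls       a [])       (suc p) = refl
  place right (tape ls       a (r ∷ rs)) zero    = refl
  place right (tape ls       a (r ∷ rs)) (suc p) = refl

track-blank : ∀ {A} (t : Tape A) {p} → size t ≤ p → track t p ≡ blankTrack
track-blank t@(tape ls a rs) {p} s≤p = cong₂ _,_
  (nth-≥ nothing (cells t) p (≤-trans (≤-reflexive (length-ʳ++ ls)) s≤p))
  (away (≤-trans (≤-reflexive (+-comm 1 _)) (≤-trans (+-monoʳ-≤ (length ls) (s≤s z≤n)) s≤p)))
  where
  away : ∀ {m n} → m < n → (n ≡ᵇ m) ≡ false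
  away {zero}  (s≤s _)   = refl
  away {suc m} (s≤s m<n) = away m<n

scanTrack : ∀ {A} → Maybe A → Track A → Maybe A
scanTrack old (a , marked) = if marked then a else old

-- Positions beyond `xs` count as unmarked, so the marked position `h` lies inside. After it the
-- fold meets no further mark and keeps the symbol found there.
scanTracks-head : ∀ {A} (xs : List (Track A)) {old} h (g : ℕ → Maybe A) →
  (∀ p → nth blankTrack xs p ≡ (g p , (p ≡ᵇ h))) → foldl scanTrack old xs ≡ g h
scanTracks-head []       h       g e = contradiction (trans (cong proj₂ (e h)) (≡ᵇ-refl h)) λ ()
  where
  ≡ᵇ-refl : ∀ h → (h ≡ᵇ h) ≡ true
  ≡ᵇ-refl zero    = refl
  ≡ᵇ-refl (suc h) = ≡ᵇ-refl h
scanTracks-head (x ∷ xs) (suc h) g e rewrite e 0 = scanTracks-head xs h (g ∘ suc) (e ∘ suc)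
scanTracks-head (x ∷ xs) zero    g e rewrite e 0 = unmarked xs (cong proj₂ ∘ e ∘ suc)
  where
  unmarked : ∀ xs {old} → (∀ p → proj₂ (nth blankTrack xs p) ≡ false) → foldl scanTrack old xs ≡ old
  unmarked []             e = refl
  unmarked ((_ , _) ∷ xs) e rewrite e 0 = unmarked xs (e ∘ suc)

upToBlank-nth : ∀ {A : Set} (xs ys : List (Maybe A)) → (∀ p → nth nothing xs p ≡ nth nothing ys p) →
  upToBlank xs ≡ upToBlank ys
upToBlank-nth []             []             e = refl
upToBlank-nth []             (nothing ∷ ys) e = refl
upToBlank-nth []             (just _ ∷ ys)  e = case e 0 of λ ()
upToBlank-nth (nothing ∷ xs) []             e = refl
upToBlank-nth (nothing ∷ xs) (nothing ∷ ys) e = refl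
upToBlank-nth (nothing ∷ xs) (just _ ∷ ys)  e = case e 0 of λ ()
upToBlank-nth (just _ ∷ xs)  []             e = case e 0 of λ ()
upToBlank-nth (just _ ∷ xs)  (nothing ∷ ys) e = case e 0 of λ ()
upToBlank-nth (just x ∷ xs)  (just y ∷ ys)  e with e 0
... | refl = cong (x ∷_) (upToBlank-nth xs ys (e ∘ suc))

newTracks : ∀ {A n} → Vec (Maybe A × Move) n → Maybe (Vec (Track A) n) →
            Vec (Track A) n → Vec (Track A) n → Vec (Track A) n
newTracks []       l []       []       = []
newTracks (w ∷ ws) l (c ∷ cs) (r ∷ rs) =
  newTrack w (Maybe.map Vec.head l) c r ∷ newTracks ws (Maybe.map Vec.tail l) cs rs

tracks : ∀ {A n} → Vec (Tape A) n → ℕ → Vec (Track A) n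
tracks ts p = Vec.map (λ t → track t p) ts

previous-map : ∀ {A B : Set} (f : A → B) F p → Maybe.map f (previous F p) ≡ previous (f ∘ F) p
previous-map f F zero    = refl
previous-map f F (suc p) = refl

newTracks-correct : ∀ {A n} (ws : Vec (Maybe A × Move) n) (ts : Vec (Tape A) n) p →
  newTracks ws (previous (tracks ts) p) (tracks ts p) (tracks ts (suc p)) ≡ tracks (Vec.zipWith writeMove ws ts) p
newTracks-correct []       []       p = refl
newTracks-correct (w ∷ ws) (t ∷ ts) p
  rewrite previous-map Vec.head (tracks (t ∷ ts)) p | previous-map Vec.tail (tracks (t ∷ ts)) p
  = cong₂ _∷_ (newTrack-correct w t p) (newTracks-correct ws ts p)

newTracks-blank : ∀ {A n} (ws : Vec (Maybe A × Move) n) → let bs = Vec.replicate n blankTrack in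
  newTracks ws (just bs) bs bs ≡ bs
newTracks-blank []       = refl
newTracks-blank (w ∷ ws) = cong₂ _∷_ (newTrack-blank w) (newTracks-blank ws)

tracks-blank : ∀ {A n} (ts : Vec (Tape A) n) {p} → Vec.sum (Vec.map size ts) ≤ p →
  tracks ts p ≡ Vec.replicate n blankTrack
tracks-blank []       _ = refl
tracks-blank (t ∷ ts) l = cong₂ _∷_ (track-blank t (m+n≤o⇒m≤o _ l)) (tracks-blank ts (m+n≤o⇒n≤o (size t) l))

lookup-ext : ∀ {A : Set} {n} (v w : Vec A n) → (∀ j → Vec.lookup v j ≡ Vec.lookup w j) → v ≡ w
lookup-ext []      []      e = refl
lookup-ext (_ ∷ v) (_ ∷ w) e = cong₂ _∷_ (e zero) (lookup-ext v w (e ∘ suc))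

downFrom : ∀ {A : Set} → (ℕ → A) → ℕ → List A
downFrom F zero    = []
downFrom F (suc m) = F m ∷ downFrom F m

-- Columns popped from the right end appear as the values of `F` in descending order, the form on
-- which `rewriteFrom-correct` inducts.
ʳ++-downFrom : ∀ {A : Set} {d} (F : ℕ → A) w k → (∀ p → nth d w p ≡ F (k + p)) →
  w ʳ++ downFrom F k ≡ downFrom F (k + length w)
ʳ++-downFrom F []      k e = cong (downFrom F) (sym (+-identityʳ k))
ʳ++-downFrom {d = d} F (x ∷ w) k e = trans
  (cong (λ y → w ʳ++ y ∷ downFrom F k) (trans (e 0) (cong F (+-identityʳ k))))
  (trans (ʳ++-downFrom {d = d} F w (suc k) (λ p → trans (e (suc p)) (cong F (+-suc k p))))
         (cong (downFrom F) (sym (+-suc k (length w)))))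

-- Configurations as strings of columns

data Outcome (C : Set) : Set where
  halted : Bool → Outcome C
  single : C → Outcome C
  double : C → C → Outcome C

module Columns (N : NTM) where
  open NTM N
  open Machine machine

  -- A cell of the address tape and of each work tape, all at the same position.
  Column : Set
  Column = Track Bit × Vec (Track Symbol) tapes

  Header : Set
  Header = State × Maybe Bit

  -- Of the choice tape only the last bit is kept; trailing blank columns are omitted.
  Conf : Set
  Conf = Header × List Column

  Current : Set
  Current = Maybe Bit × Vec (Maybe Symbol) tapes

  View : Set
  View = Header × Maybe InputSymbol × Current

  NAction : Set
  NAction = Action State Symbol Move tapes

  abstract
    finite-Track : ∀ {A} → Finite A → Finite (Track A)
    finite-Track fin = finite-× (finite-Maybe fin) finite-Bool

    finite-Column : Finite Column
    finite-Column = finite-× (finite-Track finite-Fin) (finite-Vec tapes (finite-Track finiteSymbol))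

    finite-Header : Finite Header
    finite-Header = finite-× finiteState (finite-Maybe finite-Fin)

    finite-Current : Finite Current
    finite-Current = finite-× (finite-Maybe finite-Fin) (finite-Vec tapes (finite-Maybe finiteSymbol))

    finite-View : Finite View
    finite-View = finite-× finite-Header (finite-× (finite-Maybe finite-InputSymbol) finite-Current)

    _≟ᶜ_ : DecidableEquality Column
    _≟ᶜ_ = finite-≟ finite-Column

    _≟ʰ_ : DecidableEquality Header
    _≟ʰ_ = finite-≟ finite-Header

  blankColumn : Column
  blankColumn = blankTrack , Vec.replicate tapes blankTrack

  startColumn : Column
  startColumn = (nothing , true) , Vec.replicate tapes (nothing , true)

  startConf : Conf
  startConf = (start , nothing) , startColumn ∷ []

  noCurrent : Current
  noCurrent = nothing , Vec.replicate tapes nothing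

  collect : Current → Column → Current
  collect (a , ws) (x , xs) = scanTrack a x , Vec.zipWith scanTrack ws xs

  addressCell : Column → Maybe Bit
  addressCell c = proj₁ (proj₁ c)

  view : Instance → Conf → View
  view i (h , w) = h , symbolAt i (map addressCell w) , foldl collect noCurrent w

  decide : View → Maybe NAction
  decide ((q , b) , r , (a , ws)) = δ q r a ws b

  newColumn : NAction → Maybe Column → Column → Column → Column
  newColumn a l c r =
    newTrack (Action.address a) (Maybe.map proj₁ l) (proj₁ c) (proj₁ r) ,
    newTracks (Action.work a) (Maybe.map proj₂ l) (proj₂ c) (proj₂ r)

  trim∷ : Column → List Column → List Column
  trim∷ x []         = if does (x ≟ᶜ blankColumn) then [] else x ∷ []
  trim∷ x w@(_ ∷ _)  = x ∷ w

  -- The columns are visited from right to left; c and r are the two last ones.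
  rewriteFrom : NAction → Column → Column → List Column → List Column → List Column
  rewriteFrom a c r []       q = trim∷ (newColumn a nothing c r) q
  rewriteFrom a c r (l ∷ ps) q = rewriteFrom a l c ps (trim∷ (newColumn a (just l) c r) q)

  -- The sweep starts one column beyond the right end, the furthest place a head can reach in this
  -- step; the second blank column is the right neighbour of that one.
  rewritten : NAction → List Column → List Column
  rewritten a w = rewriteFrom a blankColumn blankColumn (w ʳ++ []) []

  target : NAction → Header → Header
  target a (q , b) = Action.next a , (case Action.extra a of λ { right → just zero ; _ → b })

  branches : NAction → Bool
  branches a = case Action.extra a of λ { right → true ; _ → false }

  other : Header → Header
  other (q , _) = q , just (suc zero)

  outcomeOf : Conf → Maybe NAction → Outcome Conf
  outcomeOf ((q , _) , w) nothing  = halted (accepting q)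
  outcomeOf (h       , w) (just a) =
    if branches a then double (target a h , rewritten a w) (other (target a h) , rewritten a w)
                  else single (target a h , rewritten a w)

  outcome : Instance → Conf → Outcome Conf
  outcome i s = outcomeOf s (decide (view i s))

  column : Core machine → ℕ → Column
  column c p = track (Core.address c) p , tracks (Core.work c) p

  Trimmed : List Column → Set
  Trimmed w = ∀ m → length w ≡ suc m → nth blankColumn w m ≢ blankColumn

  record Represents (w : List Column) (F : ℕ → Column) : Set where
    constructor represents
    field
      nth≡    : ∀ p → nth blankColumn w p ≡ F p
      trimmed : Trimmed w

  column-blank : ∀ c {p} → space machine c ≤ p → column c p ≡ blankColumn
  column-blank c l = cong₂ _,_ (track-blank (Core.address c) (m+n≤o⇒m≤o _ l))
                               (tracks-blank (Core.work c) (m+n≤o⇒n≤o (size (Core.address c)) l))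

  -- All columns from position `space machine c` on are blank, and a trimmed string does not end in
  -- a blank column.
  represents-length : ∀ {w c} → Represents w (column c) → length w ≤ space machine c
  represents-length {w} {c} (represents e trimmed) with length w
  ... | zero  = z≤n
  ... | suc m with space machine c ≤? m
  ...   | yes s≤m = contradiction (trans (e m) (column-blank c s≤m)) (trimmed m refl)
  ...   | no  s≰m = ≰⇒> s≰m

  column-start : Represents (startColumn ∷ []) (column (initialCore machine))
  column-start = represents eq λ { zero _ e → case cong (proj₂ ∘ proj₁) e of λ () ; (suc m) () }
    where
    eq : ∀ p → nth blankColumn (startColumn ∷ []) p ≡ column (initialCore machine) p
    eq zero    = cong (_ ,_) (sym (Vec.map-replicate (λ t → track t 0) blankTape tapes))
    eq (suc p) = cong (_ ,_) (sym (Vec.map-replicate (λ t → track t (suc p)) blankTape tapes))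

  newColumn-correct : ∀ a c p →
    newColumn a (previous (column c) p) (column c p) (column c (suc p)) ≡ column (perform machine a c) p
  newColumn-correct a c p
    rewrite previous-map proj₁ (column c) p | previous-map proj₂ (column c) p
    = cong₂ _,_ (newTrack-correct (Action.address a) (Core.address c) p)
                (newTracks-correct (Action.work a) (Core.work c) p)

  newColumn-blank : ∀ a → newColumn a (just blankColumn) blankColumn blankColumn ≡ blankColumn
  newColumn-blank a = cong₂ _,_ (newTrack-blank (Action.address a)) (newTracks-blank (Action.work a))

  trim∷-nth : ∀ x q p → nth blankColumn (trim∷ x q) p ≡ nth blankColumn (x ∷ q) p
  trim∷-nth x (_ ∷ _) p       = refl
  trim∷-nth x []      p       with x ≟ᶜ blankColumn
  trim∷-nth x []      zero    | yes refl = refl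
  trim∷-nth x []      (suc p) | yes refl = refl
  trim∷-nth x []      p       | no _     = refl

  trim∷-trimmed : ∀ x q → Trimmed q → Trimmed (trim∷ x q)
  trim∷-trimmed x (y ∷ q) t zero    ()
  trim∷-trimmed x (y ∷ q) t (suc m) e = t m (suc-injective e)
  trim∷-trimmed x []      t m e with x ≟ᶜ blankColumn
  trim∷-trimmed x []      t m       () | yes _
  trim∷-trimmed x []      t zero    e  | no ≢blank = ≢blank
  trim∷-trimmed x []      t (suc m) () | no _

  rewriteFrom-correct : ∀ a (F G : ℕ → Column) →
    (∀ p → newColumn a (previous F p) (F p) (F (suc p)) ≡ G p) →
    ∀ m q → (∀ j → nth blankColumn q j ≡ G (suc m + j)) → Trimmed q →
    Represents (rewriteFrom a (F m) (F (suc m)) (downFrom F m) q) G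
  rewriteFrom-correct a F G new zero q e t =
    represents (λ { zero    → trans (trim∷-nth _ q 0) (new 0)
                  ; (suc p) → trans (trim∷-nth _ q (suc p)) (e p) }) (trim∷-trimmed _ q t)
  rewriteFrom-correct a F G new (suc m) q e t = rewriteFrom-correct a F G new m _
    (λ { zero    → trans (trim∷-nth _ q 0) (trans (new (suc m)) (cong (G ∘ suc) (sym (+-identityʳ m))))
       ; (suc j) → trans (trim∷-nth _ q (suc j)) (trans (e j) (cong (G ∘ suc) (sym (+-suc m j)))) })
    (trim∷-trimmed _ q t)

  rewritten-correct : ∀ a {c w} → Represents w (column c) →
    Represents (rewritten a w) (column (perform machine a c))
  rewritten-correct a {c} {w} (represents e _) =
    subst (λ ps → Represents (rewriteFrom a blankColumn blankColumn ps []) (column (perform machine a c)))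
      (sym (ʳ++-downFrom (column c) w 0 e))
      (subst₂ (λ x y → Represents (rewriteFrom a x y (downFrom (column c) (length w)) []) (column (perform machine a c)))
        (blank ≤-refl) (blank (n≤1+n _))
        (rewriteFrom-correct a (column c) _ (newColumn-correct a c) (length w) []
          (λ j → trans (sym (newColumn-blank a)) (trans (far (m≤m+n _ j)) (newColumn-correct a c _)))
          (λ _ ())))
    where
    blank : ∀ {p} → length w ≤ p → column c p ≡ blankColumn
    blank {p} l = trans (sym (e p)) (nth-≥ blankColumn w p l)
    far : ∀ {p} → length w ≤ p → newColumn a (just blankColumn) blankColumn blankColumn ≡
          newColumn a (just (column c p)) (column c (suc p)) (column c (2 + p))
    far l = trans (cong (λ x → newColumn a (just x) blankColumn blankColumn) (sym (blank l)))
      (cong₂ (newColumn a (just (column c _))) (sym (blank (m≤n⇒m≤1+n l))) (sym (blank (m≤n⇒m≤1+n (m≤n⇒m≤1+n l)))))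

  collect-address : ∀ w v → proj₁ (foldl collect v w) ≡ foldl scanTrack (proj₁ v) (map proj₁ w)
  collect-address []      v = refl
  collect-address (_ ∷ w) v = collect-address w _

  collect-work : ∀ w v j → Vec.lookup (proj₂ (foldl collect v w)) j ≡
    foldl scanTrack (Vec.lookup (proj₂ v) j) (map (λ c → Vec.lookup (proj₂ c) j) w)
  collect-work []            v j = refl
  collect-work ((_ , x) ∷ w) v j = trans (collect-work w _ j)
    (cong (λ a → foldl scanTrack a (map (λ c → Vec.lookup (proj₂ c) j) w)) (Vec.lookup-zipWith scanTrack j (proj₂ v) x))

  current≡nth : ∀ {A} (t : Tape A) → nth nothing (cells t) (length (Tape.before t)) ≡ Tape.current t
  current≡nth (tape ls a rs) = trans
    (cong (nth nothing (ls ʳ++ a ∷ rs)) (sym (+-identityʳ (length ls)))) (nth-ʳ++-≥ nothing ls {a ∷ rs} 0)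

  collect-correct : ∀ {w c} → Represents w (column c) →
    foldl collect noCurrent w ≡ (Tape.current (Core.address c) , Vec.map Tape.current (Core.work c))
  collect-correct {w} {c} (represents e _) = cong₂ _,_
    (trans (collect-address w _)
      (trans (scanTracks-head (map proj₁ w) _ _ λ p → trans (nth-map proj₁ blankColumn w p) (cong proj₁ (e p)))
             (current≡nth (Core.address c))))
    (lookup-ext _ _ λ j → trans (collect-work w _ j)
      (trans (scanTracks-head (map (λ x → Vec.lookup (proj₂ x) j) w)
                (length (Tape.before (Vec.lookup (Core.work c) j))) (nth nothing (cells (Vec.lookup (Core.work c) j))) λ p →
                trans (cong (λ d → nth d (map (λ x → Vec.lookup (proj₂ x) j) w) p) (sym (Vec.lookup-replicate j blankTrack)))
                (trans (nth-map (λ x → Vec.lookup (proj₂ x) j) blankColumn w p)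
                (trans (cong (λ x → Vec.lookup (proj₂ x) j) (e p)) (Vec.lookup-map j (λ t → track t p) (Core.work c)))))
      (trans (current≡nth (Vec.lookup (Core.work c) j)) (sym (Vec.lookup-map j Tape.current (Core.work c))))))

  symbolAt-correct : ∀ i {w c} → Represents w (column c) →
    symbolAt i (map addressCell w) ≡ scannedInput machine i c
  symbolAt-correct i {w} {c} (represents e _) = cong (λ as → head (drop (fromDigits as) (inputWord i)))
    (upToBlank-nth (map addressCell w) (cells (Core.address c))
      λ p → trans (nth-map addressCell blankColumn w p) (cong addressCell (e p)))

  -- `ahead≡` can be maintained because the choice head never moves left. Choice bits before the
  -- last one are left out, so different configurations of N may share a description.
  record Describes (c : NConfig N) (s : Conf) : Set where
    constructor describes
    field
      header≡ : proj₁ s ≡ (Core.state (NConfig.base c) , head (ChoiceTape.behind (NConfig.choice c)))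
      ahead≡  : ChoiceTape.ahead (NConfig.choice c) ≡ []
      columns : Represents (proj₂ s) (column (NConfig.base c))

  bits : NConfig N → ℕ
  bits c = bitsRead (NConfig.choice c)

  data Successors (L : List (NConfig N)) (accepted : Bool) (c : NConfig N) : Outcome Conf → Set where
    halted : L ≡ [] → Successors L accepted c (halted accepted)
    single : ∀ {c′ s′} → L ≡ c′ ∷ [] → accepted ≡ false → Describes c′ s′ → bits c′ ≡ bits c →
             Successors L accepted c (single s′)
    double : ∀ {c₀ c₁ s₀ s₁} → L ≡ c₀ ∷ c₁ ∷ [] → accepted ≡ false → Describes c₀ s₀ → Describes c₁ s₁ →
             bits c₀ ≡ suc (bits c) → bits c₁ ≡ suc (bits c) → Successors L accepted c (double s₀ s₁)

  describes-start : Describes (initialN N) startConf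
  describes-start = describes refl refl column-start

  decide-correct : ∀ i {c s} → Describes c s → decide (view i s) ≡ actionN N i c
  decide-correct i {c} (describes refl _ rep) = cong₂ (λ r v → decide (_ , r , v))
    (symbolAt-correct i {c = NConfig.base c} rep) (collect-correct {c = NConfig.base c} rep)

  successorsBy : NConfig N → Maybe NAction → List (NConfig N)
  successorsBy c nothing  = []
  successorsBy c (just a) = map (nconfig (perform machine a (NConfig.base c)))
                                (moveChoice (Action.extra a) (NConfig.choice c))

  successors≡ : ∀ i c → successors N i c ≡ successorsBy c (actionN N i c)
  successors≡ i c with actionN N i c
  ... | nothing = refl
  ... | just a  = refl

  simulates : ReadOnce N → ∀ i {c s} → Describes c s →
    Successors (successors N i c) (accepts N i c) c (outcome i s)
  simulates once i {c@(nconfig b (choices bs as))} {s@(h , w)} d@(describes refl refl rep) =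
    subst₂ (λ L m → Successors L (accepts N i c) c (outcomeOf s m)) (sym (successors≡ i c)) (sym (decide-correct i d))
      (go (actionN N i c) λ a → once _ _ _ _ _)
    where
    go : ∀ m → (∀ a → m ≡ just a → Action.extra a ≢ left) →
         Successors (successorsBy c m) (is-nothing m ∧ accepting (Core.state b)) c (outcomeOf s m)
    go nothing  ok = halted refl
    go (just a) ok with Action.extra a in x
    ... | left  = contradiction x (ok a refl)
    ... | stay  = single refl refl (describes refl refl (rewritten-correct a {b} rep)) refl
    ... | right = double refl refl (describes refl refl (rewritten-correct a {b} rep))
                                   (describes refl refl (rewritten-correct a {b} rep)) refl refl

-- Memoised depth-first search

unique-length : ∀ {A : Set} {xs ys : List A} → Unique xs → (∀ {x} → x ∈ xs → x ∈ ys) → length xs ≤ length ys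
unique-length {xs = xs} {ys} u sub = injective⇒≤ {f = λ j → Any.index (sub (∈-lookup j))} λ {j} {k} e →
  injective u j k (trans (lookup-index (sub (∈-lookup j))) (trans (cong (lookup ys) e) (sym (lookup-index (sub (∈-lookup k))))))
  where
  injective : ∀ {xs} → Unique xs → ∀ j k → lookup xs j ≡ lookup xs k → j ≡ k
  injective (_ ∷ u) zero    zero    e = refl
  injective (a ∷ u) zero    (suc k) e = contradiction e (All.lookup a (∈-lookup k))
  injective (a ∷ u) (suc j) zero    e = contradiction (sym e) (All.lookup a (∈-lookup j))
  injective (_ ∷ u) (suc j) (suc k) e = cong suc (injective u j k e)

module Search (N : NTM) (once : ReadOnce N) (i : Instance) where
  open Columns N

  -- The count is required of every configuration that `s` describes, whatever choice bits led to
  -- it; this makes a value found along one path reusable along another.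
  Val : Conf → ℕ → Set
  Val s v = ∀ c → Describes c s → AcceptingPath N i c ↔ Fin v

  path↔ : ∀ c → AcceptingPath N i c ↔ (T (accepts N i c) ⊎ Any (AcceptingPath N i) (successors N i c))
  path↔ c = mk↔ₛ′ (λ { (accept a) → inj₁ a ; (step p) → inj₂ p }) (λ { (inj₁ a) → accept a ; (inj₂ p) → step p })
    (λ { (inj₁ _) → refl ; (inj₂ _) → refl }) (λ { (accept _) → refl ; (step _) → refl })

  infixr 9 _⊙_
  _⊙_ : ∀ {A B C : Set} → A ↔ B → B ↔ C → A ↔ C
  f ⊙ g = g ↔-∘ f

  T↔ : ∀ b → T b ↔ Fin (if b then 1 else 0)
  T↔ true  = ↔-sym 1↔⊤
  T↔ false = ↔-sym 0↔⊥

  any[] : ∀ {L} → L ≡ [] → Any (AcceptingPath N i) L ↔ Fin 0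
  any[] refl = ↔-sym ⊥↔Any[] ⊙ ↔-sym 0↔⊥

  any∷ : ∀ {L c L′ m n} → L ≡ c ∷ L′ → AcceptingPath N i c ↔ Fin m → Any (AcceptingPath N i) L′ ↔ Fin n →
    Any (AcceptingPath N i) L ↔ Fin (m + n)
  any∷ refl f g = ↔-sym (∷↔ _) ⊙ (f ⊎-↔ g) ⊙ ↔-sym +↔⊎

  paths↔ : ∀ {c b n} → accepts N i c ≡ b → Any (AcceptingPath N i) (successors N i c) ↔ Fin n →
    AcceptingPath N i c ↔ Fin ((if b then 1 else 0) + n)
  paths↔ {c} refl g = path↔ c ⊙ (T↔ _ ⊎-↔ g) ⊙ ↔-sym +↔⊎

  val-halted : ∀ {s b} → outcome i s ≡ halted b → Val s (if b then 1 else 0)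
  val-halted {s} {b} e c d = go (outcome i s) e (simulates once i d)
    where
    go : ∀ o → o ≡ halted b → Successors (successors N i c) (accepts N i c) c o → AcceptingPath N i c ↔ Fin (if b then 1 else 0)
    go .(halted _) refl (halted L≡) = subst (λ n → AcceptingPath N i c ↔ Fin n) (+-identityʳ _) (paths↔ refl (any[] L≡))

  val-single : ∀ {s s′ v} → outcome i s ≡ single s′ → Val s′ v → Val s v
  val-single {s} {s′} {v} e val c d = go (outcome i s) e (simulates once i d)
    where
    go : ∀ o → o ≡ single s′ → Successors (successors N i c) (accepts N i c) c o → AcceptingPath N i c ↔ Fin v
    go _ refl (single L≡ a d′ _) = subst (λ n → AcceptingPath N i c ↔ Fin n) (+-identityʳ _)
      (paths↔ a (any∷ L≡ (val _ d′) (any[] refl)))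

  val-double : ∀ {s s₀ s₁ v₀ v₁} → outcome i s ≡ double s₀ s₁ → Val s₀ v₀ → Val s₁ v₁ → Val s (v₀ + v₁)
  val-double {s} {s₀} {s₁} {v₀} {v₁} e val₀ val₁ c d = go (outcome i s) e (simulates once i d)
    where
    go : ∀ o → o ≡ double s₀ s₁ → Successors (successors N i c) (accepts N i c) c o → AcceptingPath N i c ↔ Fin (v₀ + v₁)
    go _ refl (double L≡ a d₀ d₁ _ _) = subst (λ n → AcceptingPath N i c ↔ Fin n) (cong (v₀ +_) (+-identityʳ _))
      (paths↔ a (any∷ L≡ (val₀ _ d₀) (any∷ refl (val₁ _ d₁) (any[] refl))))

  -- The index counts the nondeterministic steps.
  data Path (s : Conf) : ℕ → Conf → Set where
    []     : Path s 0 s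
    single : ∀ {t u n} → outcome i s ≡ single t → Path t n u → Path s n u
    left   : ∀ {t t′ u n} → outcome i s ≡ double t t′ → Path t n u → Path s (suc n) u
    right  : ∀ {t t′ u n} → outcome i s ≡ double t′ t → Path t n u → Path s (suc n) u

  _++ᵖ_ : ∀ {s t u m n} → Path s m t → Path t n u → Path s (m + n) u
  []         ++ᵖ q = q
  single e p ++ᵖ q = single e (p ++ᵖ q)
  left e p   ++ᵖ q = left e (p ++ᵖ q)
  right e p  ++ᵖ q = right e (p ++ᵖ q)

  power : ∀ {s n} k → Path s n s → Path s (k * n) s
  power zero    p = []
  power (suc k) p = p ++ᵖ power k p

  Lift : ℕ → NConfig N → Conf → Set
  Lift n c t = ∃ λ c′ → Star (λ c d → d ∈ successors N i c) c c′ × Describes c′ t × bits c′ ≡ n + bits c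

  -- `Path` lives on strings, whereas the bound on choice bits concerns N. Following the path in N
  -- reads one new bit for each nondeterministic step.
  lift : ∀ {s n t c} → Path s n t → Describes c s → Lift n c t
  lift {c = c} [] d = c , ε , d , refl
  lift {s} {n} {t} {c} (single e p) d = go _ e (simulates once i d)
    where
    go : ∀ o → o ≡ single _ → Successors (successors N i c) (accepts N i c) c o → Lift n c t
    go _ refl (single L≡ _ d′ b≡) = let c′ , r , d″ , b = lift p d′ in
      c′ , subst (_ ∈_) (sym L≡) (here refl) ◅ r , d″ , trans b (cong (n +_) b≡)
  lift {s} {suc n} {t} {c} (left e p) d = go _ e (simulates once i d)
    where
    go : ∀ o → o ≡ double _ _ → Successors (successors N i c) (accepts N i c) c o → Lift (suc n) c t
    go _ refl (double L≡ _ d′ _ b≡ _) = let c′ , r , d″ , b = lift p d′ in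
      c′ , subst (_ ∈_) (sym L≡) (here refl) ◅ r , d″ , trans b (trans (cong (n +_) b≡) (+-suc n _))
  lift {s} {suc n} {t} {c} (right e p) d = go _ e (simulates once i d)
    where
    go : ∀ o → o ≡ double _ _ → Successors (successors N i c) (accepts N i c) c o → Lift (suc n) c t
    go _ refl (double L≡ _ _ d′ _ b≡) = let c′ , r , d″ , b = lift p d′ in
      c′ , subst (_ ∈_) (sym L≡) (there (here refl)) ◅ r , d″ , trans b (trans (cong (n +_) b≡) (+-suc n _))

  ReachableConf : Conf → Set
  ReachableConf s = ∃ λ c → Reachable N i c × Describes c s

  reach-path : ∀ {s n t} → ReachableConf s → Path s n t → ReachableConf t
  reach-path (c , r , d) p = let c′ , r′ , d′ , _ = lift p d in c′ , r ◅◅ r′ , d′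

  -- The index 0 leaves only deterministic steps. The closing step is kept apart from the path, so
  -- the cycle has at least one step even if the path is empty.
  Cyclic : Conf → Set
  Cyclic a = ∃ λ s → Path a 0 s × outcome i s ≡ single a

  rotate : ∀ {a} → Cyclic a → ∃ λ b → outcome i a ≡ single b × Cyclic b
  rotate     (s , []          , e) = _ , e , s , [] , e
  rotate {a} (s , single e′ p , e) = _ , e′ , a , p ++ᵖ single e [] , e′

  -- Each configuration on the cycle has exactly one successor, again on the cycle, and none of them
  -- accepts. The induction is on the accepting path, which loses its first step as the cycle is
  -- rotated.
  cyclic-rejects : ∀ {a c} → Cyclic a → Describes c a → ¬ AcceptingPath N i c
  cyclic-rejects {a} {c} cyc d q = let b , e , cyc′ = rotate cyc in go e cyc′ q (simulates once i d)
    where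
    tail-rejects : ∀ {b c′ L} → Cyclic b → Describes c′ b → L ≡ c′ ∷ [] → ¬ Any (AcceptingPath N i) L
    tail-rejects cyc d refl (here q) = cyclic-rejects cyc d q

    go : ∀ {b o} → o ≡ single b → Cyclic b → AcceptingPath N i c → ¬ Successors (successors N i c) (accepts N i c) c o
    go refl cyc (accept t) (single _ rejects _ _) = subst T rejects t
    go refl cyc (step any) (single L≡ _ d′ _)     = tail-rejects cyc d′ L≡ any

  -- The table and one iteration of the search

  Entry : Set
  Entry = Conf × List Bit

  -- The comparison goes on after a mismatch because the program has to move the whole key off the
  -- stack in any case.
  matchColumns : Bool → List Column → List Column → Bool
  matchColumns e []       []       = e
  matchColumns e []       (_ ∷ _)  = false
  matchColumns e (_ ∷ cs) []       = matchColumns false cs []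
  matchColumns e (c ∷ cs) (q ∷ qs) = matchColumns (e ∧ does (c ≟ᶜ q)) cs qs

  match : Conf → Conf → Bool
  match (h , w) (h′ , w′) = matchColumns (does (h ≟ʰ h′)) w w′

  match-refl : ∀ s → match s s ≡ true
  match-refl (h , w) with h ≟ʰ h
  ... | no  h≢h = contradiction refl h≢h
  ... | yes _   = go w
    where
    go : ∀ w → matchColumns true w w ≡ true
    go []      = refl
    go (c ∷ w) with c ≟ᶜ c
    ... | yes _   = go w
    ... | no  c≢c = contradiction refl c≢c

  match⇒≡ : ∀ s t → match s t ≡ true → s ≡ t
  match⇒≡ (h , w) (h′ , w′) m with h ≟ʰ h′
  ... | no _     = case trans (sym (go w w′)) m of λ ()
    where
    go : ∀ w w′ → matchColumns false w w′ ≡ false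
    go []      []       = refl
    go []      (_ ∷ _)  = refl
    go (_ ∷ w) []       = go w []
    go (_ ∷ w) (_ ∷ w′) = go w w′
  ... | yes refl = cong (h ,_) (go w w′ m)
    where
    fails : ∀ w w′ → matchColumns false w w′ ≢ true
    fails []      []       ()
    fails []      (_ ∷ _)  ()
    fails (_ ∷ w) []       = fails w []
    fails (_ ∷ w) (_ ∷ w′) = fails w w′

    go : ∀ w w′ → matchColumns true w w′ ≡ true → w ≡ w′
    go []      []       m = refl
    go (c ∷ w) []       m = contradiction m (fails w [])
    go (c ∷ w) (q ∷ w′) m with c ≟ᶜ q
    ... | yes refl = cong (c ∷_) (go w w′ m)
    ... | no  _    = contradiction m (fails w w′)

  -- The table lists the opened configurations with value 0, and once more, with
  -- their number of accepting paths, those that have been completed.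
  member : Conf → List Entry → Bool → Bool
  member t []            f = f
  member t ((s , _) ∷ D) f = member t D (f ∨ match s t)

  -- A fold in the order in which the program meets the entries. Summing all entries with key `t`
  -- avoids having to find the completed one: the entry made at the opening contributes 0.
  collectValues : Conf → List Entry → List Bit → List Bit
  collectValues t []            A = A
  collectValues t ((s , v) ∷ D) A = collectValues t D (if match s t then addBits false v A else A)

  total : Conf → List Entry → ℕ
  total t []            = 0
  total t ((s , v) ∷ D) = (if match s t then fromDigits v else 0) + total t D

  SearchState : Set
  SearchState = List Conf × List Entry

  launch : Conf → List Conf → List Entry → SearchState
  launch t S D = t ∷ S , (t , []) ∷ D

  finish : Conf → List Bit → List Conf → List Entry → SearchState
  finish s A S D = S , (s , A) ∷ D

  -- No return address is stored. A configuration waits below the successor that was launched and is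
  -- expanded from the start again once that one has been completed, finding at least one more
  -- successor in the table.
  expandBy : Outcome Conf → Conf → List Conf → List Entry → SearchState
  expandBy (halted b)   s S D = finish s (carryBits b) S D
  expandBy (single t)   s S D =
    if member t D false then finish s (collectValues t D []) S D else launch t (s ∷ S) D
  expandBy (double t u) s S D =
    if member t D false
    then (if member u D false then finish s (collectValues u D (collectValues t D [])) S D else launch u (s ∷ S) D)
    else launch t (s ∷ S) D

  expand : Conf → List Conf → List Entry → SearchState
  expand s = expandBy (outcome i s) s

  member-true : ∀ t D → member t D true ≡ true
  member-true t []      = refl
  member-true t (_ ∷ D) = member-true t D

  member-here : ∀ t {v} D → member t ((t , v) ∷ D) false ≡ true
  member-here t D rewrite match-refl t = member-true t D

  member-there : ∀ t e D → member t D false ≡ true → member t (e ∷ D) false ≡ true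
  member-there t (s , v) D m with match s t
  ... | true  = member-true t D
  ... | false = m

  member-inv : ∀ t s v D → member t ((s , v) ∷ D) false ≡ true → s ≡ t ⊎ member t D false ≡ true
  member-inv t s v D m with match s t in e
  ... | true  = inj₁ (match⇒≡ s t e)
  ... | false = inj₂ m

  total-∉ : ∀ t D → member t D false ≡ false → total t D ≡ 0
  total-∉ t []            m = refl
  total-∉ t ((s , v) ∷ D) m with match s t
  ... | true  = case trans (sym (member-true t D)) m of λ ()
  ... | false = total-∉ t D m

  total-here : ∀ t v D → total t ((t , v) ∷ D) ≡ fromDigits v + total t D
  total-here t v D rewrite match-refl t = refl

  total-there : ∀ {s t} v D → s ≢ t → total t ((s , v) ∷ D) ≡ total t D
  total-there {s} {t} v D s≢t with match s t in e
  ... | true  = contradiction (match⇒≡ s t e) s≢t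
  ... | false = refl

  total-[] : ∀ s t D → total t ((s , []) ∷ D) ≡ total t D
  total-[] s t D with match s t
  ... | true  = refl
  ... | false = refl

  collectValues-correct : ∀ t D A → fromDigits (collectValues t D A) ≡ total t D + fromDigits A
  collectValues-correct t []            A = refl
  collectValues-correct t ((s , v) ∷ D) A with match s t
  ... | false = collectValues-correct t D A
  ... | true  = trans (collectValues-correct t D (addBits false v A))
    (trans (cong (total t D +_) (addBits-correct false v A))
    (trans (sym (+-assoc (total t D) (fromDigits v) _)) (cong (_+ fromDigits A) (+-comm (total t D) (fromDigits v)))))

  collectValues-canonical : ∀ t {D A} → All (Canonical ∘ proj₂) D → Canonical A → Canonical (collectValues t D A)
  collectValues-canonical t []                    c = c
  collectValues-canonical t {(s , v) ∷ D} (p ∷ ps) c with match s t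
  ... | false = collectValues-canonical t ps c
  ... | true  = collectValues-canonical t ps (addBits-canonical p c)

  -- A sum has at most one bit more than its longer summand, and the summand from the table has at
  -- most `G` bits. So the accumulator has at most `G + j` bits after `j` additions.
  collectValues-length : ∀ t {D A G} j → All (λ e → length (proj₂ e) ≤ G) D → length A ≤ G + j →
    length (collectValues t D A) ≤ G + (length D + j)
  collectValues-length t j [] l = l
  collectValues-length t {(s , v) ∷ D} {A} {G} j (p ∷ ps) l =
    subst (length (collectValues t ((s , v) ∷ D) A) ≤_) (cong (G +_) (+-suc (length D) j)) (go (match s t))
    where
    go : ∀ b → length (collectValues t D (if b then addBits false v A else A)) ≤ G + (length D + suc j)
    go false = collectValues-length t (suc j) ps (≤-trans l (+-monoʳ-≤ G (n≤1+n j)))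
    go true  = collectValues-length t (suc j) ps (≤-trans (addBits-length false v A)
      (≤-trans (s≤s (⊔-lub (≤-trans p (m≤m+n G j)) l)) (≤-reflexive (sym (+-suc G j)))))

  data Edge (s t : Conf) : Set where
    single : outcome i s ≡ single t → Edge s t
    first  : ∀ {u} → outcome i s ≡ double t u → Edge s t
    second : ∀ {u} → outcome i s ≡ double u t → Edge s t

  edge-path : ∀ {s t} → Edge s t → ∃ λ n → Path s n t
  edge-path (single e) = 0 , single e []
  edge-path (first e)  = 1 , left e []
  edge-path (second e) = 1 , right e []

  record Sized (W G : ℕ) (s : Conf) (D : List Entry) : Set where
    field
      columns≤ : length (proj₂ s) ≤ W
      next≤    : ∀ {t} → Edge s t → length (proj₂ t) ≤ W
      entries≤ : All (λ e → length (proj₂ (proj₁ e)) ≤ W × length (proj₂ e) ≤ G) D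
      -- An iteration performs at most two lookups, each with at most `length D` additions into the
      -- same accumulator.
      values≤  : G + (length D + length D) ≤ W
      W≥1      : 1 ≤ W

  -- The interface between search and program: a complete run with the size bounds that govern its
  -- cost. The meaning of the values enters only at the end, in `stop`.
  data Trace (W : ℕ) : ℕ → SearchState → Set where
    stop : ∀ {A D} → Val startConf (fromDigits A) → Canonical A → length (proj₂ startConf) + length A ≤ W + W →
           Trace W 0 ([] , (startConf , A) ∷ D)
    next : ∀ {n G s S D} → Sized W G s D → Trace W n (expand s S D) → Trace W (suc n) (s ∷ S , D)


  -- Correctness of the values in the table

  module Bounded (K : ℕ) (bounded : ∀ c → Reachable N i c → bits c ≤ K) where

    -- If the cycle contained a nondeterministic step, going round it `K + 1` times would read more
    -- than `K` choice bits.
    cycle-deterministic : ∀ {s n} → ReachableConf s → Path s n s → n ≡ 0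
    cycle-deterministic {n = zero}  r           p = refl
    cycle-deterministic {n = suc n} (c , r , d) p =
      let c′ , r′ , _ , b = lift (power (suc K) p) d in
      contradiction (≤-trans (≤-trans (m≤m*n (suc K) (suc n)) (m≤m+n _ (bits c)))
                             (≤-trans (≤-reflexive (sym b)) (bounded c′ (r ◅◅ r′)))) 1+n≰n

    val-cycle : ∀ {a s n} → ReachableConf a → Path a n s → Edge s a → Val a 0
    val-cycle {a} {s} {n} r p (single e) c d = mk↔ₛ′ (λ x → contradiction x rejects) (λ ()) (λ ()) (λ x → contradiction x rejects)
      where
      p₀ : Path a 0 s
      p₀ = subst (λ n → Path a n s) (m+n≡0⇒m≡0 n (cycle-deterministic r (p ++ᵖ single e []))) p
      rejects : ¬ AcceptingPath N i c
      rejects = cyclic-rejects (_ , p₀ , e) d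
    val-cycle {n = n} r p (first e)  = contradiction (cycle-deterministic r (p ++ᵖ left e [])) (m+1+n≢0 n)
    val-cycle {n = n} r p (second e) = contradiction (cycle-deterministic r (p ++ᵖ right e [])) (m+1+n≢0 n)

    -- `O` exists only in the proof: it lists the opened configurations without repetition, so its
    -- length is bounded by their number, while `D` names completed ones twice. By `chain`, each
    -- configuration on the stack leads to all those above it.
    record Invariant (S : List Conf) (D : List Entry) (O : List Conf) : Set where
      field
        unique-opened : Unique O
        reachable     : All ReachableConf O
        listed⇒opened : ∀ {t} → member t D false ≡ true → t ∈ O
        opened⇒listed : ∀ {t} → t ∈ O → member t D false ≡ true
        chain         : AllPairs (λ u l → ∃ λ n → Path l n u) S
        unique-stack  : Unique S
        pending       : All (λ s → s ∈ O × total s D ≡ 0) S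
        completed     : ∀ {t} → t ∈ O → t ∈ S ⊎ Val t (total t D)
        canonical     : All (Canonical ∘ proj₂) D

    module _ {s S D O} (inv : Invariant (s ∷ S) D O) where
      open Invariant inv

      finish-invariant : ∀ {A} → Canonical A → Val s (fromDigits A) → Invariant S ((s , A) ∷ D) O
      finish-invariant {A} can val = record
        { unique-opened = unique-opened
        ; reachable     = reachable
        ; listed⇒opened = λ {t} m → case member-inv t s A D m of λ
            { (inj₁ refl) → proj₁ (All.head pending) ; (inj₂ m) → listed⇒opened m }
        ; opened⇒listed = λ {t} t∈O → member-there t (s , A) D (opened⇒listed t∈O)
        ; chain         = case chain of λ { (_ ∷ c) → c }
        ; unique-stack  = case unique-stack of λ { (_ ∷ u) → u }
        ; pending       = case unique-stack of λ { (s≢ ∷ _) →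
            All.map (λ (s≢t , t∈O , z) → t∈O , trans (total-there A D s≢t) z) (All.zip (s≢ , All.tail pending)) }
        ; completed     = now
        ; canonical     = can ∷ canonical }
        where
        val′ : Val s (total s ((s , A) ∷ D))
        val′ = subst (Val s) (sym (trans (total-here s A D)
          (trans (cong (fromDigits A +_) (proj₂ (All.head pending))) (+-identityʳ _)))) val

        now : ∀ {t} → t ∈ O → t ∈ S ⊎ Val t (total t ((s , A) ∷ D))
        now {t} t∈O with completed t∈O
        ... | inj₁ (here refl) = inj₂ val′
        ... | inj₁ (there t∈S) = inj₁ t∈S
        ... | inj₂ v with match s t in e
        ...   | false = inj₂ v
        ...   | true with match⇒≡ s t e
        ...     | refl = inj₂ (subst (λ b → Val s ((if b then fromDigits A else 0) + total s D)) e val′)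

      launch-invariant : ∀ {t} → Edge s t → member t D false ≡ false →
        Invariant (t ∷ s ∷ S) ((t , []) ∷ D) (t ∷ O)
      launch-invariant {t} e new = record
        { unique-opened = All.tabulate (λ x∈O t≡x → t∉O (subst (_∈ O) (sym t≡x) x∈O)) ∷ unique-opened
        ; reachable     = reach-path (All.lookup reachable (proj₁ (All.head pending))) (proj₂ (edge-path e)) ∷ reachable
        ; listed⇒opened = λ {x} m → case member-inv x t [] D m of λ { (inj₁ refl) → here refl ; (inj₂ m) → there (listed⇒opened m) }
        ; opened⇒listed = λ { (here refl) → member-here t {[]} D ; {x} (there x∈O) → member-there x (t , []) D (opened⇒listed x∈O) }
        ; chain         = (edge-path e ∷ below) ∷ chain
        ; unique-stack  = All.map (λ (x∈O , _) t≡x → t∉O (subst (_∈ O) (sym t≡x) x∈O)) pending ∷ unique-stack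
        ; pending       = (here refl , trans (total-[] t t D) (total-∉ t D new)) ∷
            All.map (λ {x} (x∈O , z) → there x∈O , trans (total-[] t x D) z) pending
        ; completed     = λ { (here refl) → inj₁ (here refl)
                            ; {x} (there x∈O) → case completed x∈O of λ
                                { (inj₁ x∈S) → inj₁ (there x∈S)
                                ; (inj₂ v)   → inj₂ (subst (Val x) (sym (total-[] t x D)) v) } }
        ; canonical     = [] ∷ canonical }
        where
        t∉O : t ∉ O
        t∉O t∈O = case trans (sym (opened⇒listed t∈O)) new of λ ()

        below : All (λ l → ∃ λ n → Path l n t) S
        below = case chain of λ { (c ∷ _) → All.map (λ (n , p) → _ , p ++ᵖ proj₂ (edge-path e)) c }

      value-known : ∀ {t} → Edge s t → member t D false ≡ true → Val t (total t D)
      value-known {t} e m with completed (listed⇒opened m)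
      ... | inj₂ v   = v
      -- `t` is `s` itself or lies below it on the stack. Then `chain` leads from `t` to `s`, and
      -- the edge back closes a cycle.
      ... | inj₁ t∈S = subst (Val t) (sym (proj₂ (All.lookup pending t∈S)))
        (val-cycle (All.lookup reachable (listed⇒opened m)) (proj₂ (to-top t∈S)) e)
        where
        to-top : ∀ {t} → t ∈ s ∷ S → ∃ λ n → Path t n s
        to-top (here refl) = 0 , []
        to-top (there t∈S) = case chain of λ { (c ∷ _) → All.lookup c t∈S }

    start-invariant : Invariant (startConf ∷ []) ((startConf , []) ∷ []) (startConf ∷ [])
    start-invariant = record
      { unique-opened = [] ∷ []
      ; reachable     = (_ , ε , describes-start) ∷ []
      ; listed⇒opened = λ {x} m → case member-inv x startConf [] [] m of λ { (inj₁ refl) → here refl ; (inj₂ ()) }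
      ; opened⇒listed = λ { (here refl) → member-here startConf {[]} [] }
      ; chain         = [] ∷ []
      ; unique-stack  = [] ∷ []
      ; pending       = (here refl , total-[] startConf startConf []) ∷ []
      ; completed     = inj₁
      ; canonical     = [] ∷ [] }

    -- Termination, and the length of the stored numbers

    module SearchIn (universe : List Conf) (covers : ∀ {s} → ReachableConf s → s ∈ universe)
             (W M : ℕ) (short : ∀ {s} → ReachableConf s → length (proj₂ s) ≤ W) where

      U : ℕ
      U = length universe

      opened≤U : ∀ {S D O} → Invariant S D O → length O ≤ U
      opened≤U inv = unique-length unique-opened (λ t∈O → covers (All.lookup reachable t∈O))
        where open Invariant inv

      -- `m` bounds the iterations still to come. By `fuel` it is at least `length S` plus twice the
      -- number of unopened configurations: an element of the stack still needs its completion, an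
      -- unopened configuration a launch and a completion. Every iteration adds exactly one entry,
      -- hence `table≤M`; and it lengthens the values by at most `M + M` bits, hence `room`.
      record Progress (m : ℕ) (S : List Conf) (D : List Entry) (O : List Conf) : Set where
        field
          invariant : Invariant S D O
          bottom    : ∃ λ xs → S ≡ xs ++ startConf ∷ []
          fuel      : length S + (U + U) ≤ m + (length O + length O)
          table≤M   : length D + m ≤ M
          G         : ℕ
          values    : All (λ e → length (proj₂ e) ≤ G) D
          keys      : All (λ e → length (proj₂ (proj₁ e)) ≤ W) D
          positive  : 0 < G
          room      : G + m * (M + M) ≤ W

      trace : ∀ m {s S D O} → Progress m (s ∷ S) D O → ∃ λ n → n ≤ m × Trace W n (s ∷ S , D)
      trace zero {S = S} p = contradiction (≤-trans fuel (+-mono-≤ (opened≤U invariant) (opened≤U invariant)))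
        (<⇒≱ (s≤s (m≤n+m (U + U) (length S))))
        where open Progress p
      trace (suc m) {s} {S} {D} {O} p = let n , n≤m , tr = go (outcome i s) refl in
        suc n , s≤s n≤m , next {G = G} sized tr
        where
        open Progress p
        open Invariant invariant

        here-reachable : ReachableConf s
        here-reachable = All.lookup reachable (proj₁ (All.head pending))

        D≤M : length D ≤ M
        D≤M = m+n≤o⇒m≤o _ table≤M

        room′ : (G + (M + M)) + m * (M + M) ≤ W
        room′ = ≤-trans (≤-reflexive (+-assoc G (M + M) _)) room

        D+D : G + (length D + length D) ≤ G + (M + M)
        D+D = +-monoʳ-≤ G (+-mono-≤ D≤M D≤M)

        sized : Sized W G s D
        sized = record
          { columns≤ = short here-reachable
          ; next≤    = λ e → short (reach-path here-reachable (proj₂ (edge-path e)))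
          ; entries≤ = All.zip (keys , values)
          ; values≤  = ≤-trans D+D (m+n≤o⇒m≤o _ room′)
          ; W≥1      = ≤-trans positive (m+n≤o⇒m≤o _ room) }

        finished : ∀ {A} → Canonical A → Val s (fromDigits A) → length A ≤ G + (M + M) →
          ∃ λ n → n ≤ m × Trace W n (S , (s , A) ∷ D)
        finished {A} can val l = go bottom S refl
          where
          go : (∃ λ xs → s ∷ S ≡ xs ++ startConf ∷ []) → ∀ S′ → S ≡ S′ → ∃ λ n → n ≤ m × Trace W n (S′ , (s , A) ∷ D)
          go ([] , refl)      _        refl = 0 , z≤n , stop val can
            (+-mono-≤ (short here-reachable) (≤-trans l (m+n≤o⇒m≤o _ room′)))
          go (x ∷ [] , refl)      []       ()
          go (x ∷ y ∷ xs , refl)  []       ()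
          go (x ∷ xs , eq)    (s′ ∷ S′) refl = trace m {s′} {S′} {(s , A) ∷ D} {O} record
            { invariant = finish-invariant invariant can val
            ; bottom    = xs , ∷-injectiveʳ eq
            ; fuel      = s≤s⁻¹ fuel
            ; table≤M   = ≤-trans (≤-reflexive (sym (+-suc _ m))) table≤M
            ; G         = G + (M + M)
            ; values    = l ∷ All.map (λ v → ≤-trans v (m≤m+n G _)) values
            ; keys      = short here-reachable ∷ keys
            ; positive  = ≤-trans positive (m≤m+n G _)
            ; room      = room′ }

        launched : ∀ {t} → Edge s t → member t D false ≡ false → ∃ λ n → n ≤ m × Trace W n (launch t (s ∷ S) D)
        launched {t} e new = trace m {t} {s ∷ S} {(t , []) ∷ D} {t ∷ O} record
          { invariant = launch-invariant invariant e new
          ; bottom    = t ∷ proj₁ bottom , cong (t ∷_) (proj₂ bottom)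
          ; fuel      = ≤-trans (s≤s fuel) (≤-reflexive (arith m (length O)))
          ; table≤M   = ≤-trans (≤-reflexive (sym (+-suc _ m))) table≤M
          ; G         = G
          ; values    = z≤n ∷ values
          ; keys      = short (reach-path here-reachable (proj₂ (edge-path e))) ∷ keys
          ; positive  = positive
          ; room      = ≤-trans (+-monoʳ-≤ G (m≤n+m _ (M + M))) room }
          where
          arith : ∀ m o → suc (suc m + (o + o)) ≡ m + (suc o + suc o)
          arith = solve 2 (λ m o → con 1 :+ (con 1 :+ m :+ (o :+ o)) := m :+ ((con 1 :+ o) :+ (con 1 :+ o))) refl
            where open +-*-Solver

        collected≤ : ∀ t {A} j → length A ≤ G + j → length (collectValues t D A) ≤ G + (length D + j)
        collected≤ t j = collectValues-length t j values

        go : ∀ o → outcome i s ≡ o → ∃ λ n → n ≤ m × Trace W n (expandBy o s S D)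
        go (halted true)  e = finished (pos one) (val-halted e) (≤-trans positive (m≤m+n G _))
        go (halted false) e = finished [] (val-halted e) z≤n
        go (single t)     e with member t D false in known
        ... | false = launched (single e) known
        ... | true  = finished (collectValues-canonical t canonical [])
          (subst (Val s) (sym (trans (collectValues-correct t D []) (+-identityʳ _)))
            (val-single e (value-known invariant (single e) known)))
          (≤-trans (collected≤ t 0 z≤n) (+-monoʳ-≤ G (+-mono-≤ D≤M z≤n)))
        go (double t u)   e with member t D false in known
        ... | false = launched (first e) known
        ... | true with member u D false in known′
        ...   | false = launched (second e) known′
        ...   | true  = finished (collectValues-canonical u canonical (collectValues-canonical t canonical []))
          (subst (Val s) (sym (trans (collectValues-correct u D _) (trans (cong (total u D +_)
              (trans (collectValues-correct t D []) (+-identityʳ _))) (+-comm (total u D) _))))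
            (val-double e (value-known invariant (first e) known) (value-known invariant (second e) known′)))
          (≤-trans (collected≤ u _ (≤-trans (collected≤ t 0 z≤n) (+-monoʳ-≤ G (≤-reflexive (+-identityʳ _)))))
                   (+-monoʳ-≤ G (+-mono-≤ D≤M D≤M)))

-- The stack machine performing the search

-- One step for the header, `2 W + 1` for comparing the key and restoring Q, and `4 + 3 W` for
-- adding or skipping the value. In all the costs, `W` bounds the number of entries and the length
-- of keys and values.
entryCost : ℕ → ℕ
entryCost W = 6 + 5 * W

lookupCost : ℕ → ℕ
lookupCost W = W * entryCost W + suc (W * suc (W + W))

iterationCost : ℕ → ℕ
iterationCost W = (3 + 3 * W) + suc ((lookupCost W + 1) + (lookupCost W + suc (4 + 4 * W)))

module Program (N : NTM) (once : ReadOnce N) where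
  open NTM N
  open Machine machine using (State; Symbol; tapes; start)
  open Columns N

  -- Three kinds of symbols make the stacks self-delimiting: an entry is a header, then columns,
  -- then bits, and a run of one kind ends at a symbol of another kind or at the bottom.
  Γ : Set
  Γ = Header ⊎ Column ⊎ Bit

  pattern hdr h = inj₁ h
  pattern col c = inj₂ (inj₁ c)
  pattern bt b  = inj₂ (inj₂ b)

  asHeader : Maybe Γ → Maybe Header
  asHeader (just (hdr h)) = just h
  asHeader _              = nothing

  asColumn : Maybe Γ → Maybe Column
  asColumn (just (col c)) = just c
  asColumn _              = nothing

  asBit : Maybe Γ → Maybe Bit
  asBit (just (bt b)) = just b
  asBit _             = nothing

  -- The header of the expanded configuration, the header of the successor that
  -- is looked up, whether another successor follows, whether it has been found.
  Context : Set
  Context = Header × Header × Bool × Bool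

  Control : Set
  Control = Bool ⊎ ⊤ ⊎ (Header × Current) ⊎ (View × Column × Column) ⊎ View ⊎ Context ⊎ (Context × Bool) ⊎
    (Context × Bool) ⊎ Context ⊎ (Context × Bool) ⊎ Context ⊎ Context ⊎ (Header × Header) ⊎ Header ⊎ Header ⊎
    Header ⊎ Header ⊎ Header ⊎ ⊤ ⊎ Fin 4

  pattern boot x    = inj₁ x
  pattern main      = inj₂ (inj₁ tt)
  pattern load x    = inj₂ (inj₂ (inj₁ x))
  pattern update x  = inj₂ (inj₂ (inj₂ (inj₁ x)))
  pattern turnP x   = inj₂ (inj₂ (inj₂ (inj₂ (inj₁ x))))
  pattern scan x    = inj₂ (inj₂ (inj₂ (inj₂ (inj₂ (inj₁ x)))))
  pattern check x = inj₂ (inj₂ (inj₂ (inj₂ (inj₂ (inj₂ (inj₁ x))))))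
  pattern turnQ₂ x  = inj₂ (inj₂ (inj₂ (inj₂ (inj₂ (inj₂ (inj₂ (inj₁ x)))))))
  pattern skip x    = inj₂ (inj₂ (inj₂ (inj₂ (inj₂ (inj₂ (inj₂ (inj₂ (inj₁ x))))))))
  pattern add x     = inj₂ (inj₂ (inj₂ (inj₂ (inj₂ (inj₂ (inj₂ (inj₂ (inj₂ (inj₁ x)))))))))
  pattern turnA₂ x  = inj₂ (inj₂ (inj₂ (inj₂ (inj₂ (inj₂ (inj₂ (inj₂ (inj₂ (inj₂ (inj₁ x))))))))))
  pattern more x    = inj₂ (inj₂ (inj₂ (inj₂ (inj₂ (inj₂ (inj₂ (inj₂ (inj₂ (inj₂ (inj₂ x))))))))))
  pattern back x    = more (inj₁ x)
  pattern saveP x   = more (inj₂ (inj₁ x))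
  pattern turnQ x   = more (inj₂ (inj₂ (inj₁ x)))
  pattern saveQ x   = more (inj₂ (inj₂ (inj₂ (inj₁ x))))
  pattern turnA x   = more (inj₂ (inj₂ (inj₂ (inj₂ (inj₁ x)))))
  pattern putA x    = more (inj₂ (inj₂ (inj₂ (inj₂ (inj₂ (inj₁ x))))))
  pattern putP x    = more (inj₂ (inj₂ (inj₂ (inj₂ (inj₂ (inj₂ (inj₁ x)))))))
  pattern clean     = more (inj₂ (inj₂ (inj₂ (inj₂ (inj₂ (inj₂ (inj₂ (inj₁ tt))))))))
  pattern out x     = more (inj₂ (inj₂ (inj₂ (inj₂ (inj₂ (inj₂ (inj₂ (inj₂ x))))))))

  -- S: the configurations under expansion; D: the table; P: the columns of the
  -- current configuration; Q: those of its successor; A: the accumulator. The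
  -- stacks with index 2 hold what has been popped while a stack is scanned.
  pattern Sˢ  = zero
  pattern Pˢ  = suc zero
  pattern P₂ˢ = suc (suc zero)
  pattern Qˢ  = suc (suc (suc zero))
  pattern Q₂ˢ = suc (suc (suc (suc zero)))
  pattern Dˢ  = suc (suc (suc (suc (suc zero))))
  pattern D₂ˢ = suc (suc (suc (suc (suc (suc zero)))))
  pattern Aˢ  = suc (suc (suc (suc (suc (suc (suc zero))))))
  pattern A₂ˢ = suc (suc (suc (suc (suc (suc (suc (suc zero)))))))

  StackActionᴾ : Set
  StackActionᴾ = StackAction Control Γ 9

  infix 6 _↦_
  _↦_ : Fin 9 → StackOp Γ → Fin 9 × StackOp Γ
  _↦_ = _,_

  ops : List (Fin 9 × StackOp Γ) → Vec (StackOp Γ) 9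
  ops = foldr (λ (j , o) v → v Vec.[ j ]≔ o) (Vec.replicate 9 keep)

  to : Control → List (Fin 9 × StackOp Γ) → Maybe StackActionᴾ
  to q os = just (act q keep (ops os) nothing)

  trimOp : Column → Maybe Γ → StackOp Γ
  trimOp x nothing  = if does (x ≟ᶜ blankColumn) then keep else push (col x)
  trimOp x (just _) = push (col x)

  newOp : Maybe NAction → Maybe Column → Column → Column → Maybe Γ → StackOp Γ
  newOp nothing  l c r q = keep
  newOp (just a) l c r q = trimOp (newColumn a l c r) q

  startLookups : Header → Maybe NAction → Maybe StackActionᴾ
  startLookups h nothing  = to (turnA h) (Aˢ ↦ (if accepting (proj₁ h) then push (bt (suc zero)) else keep) ∷ [])
  startLookups h (just a) = to (scan (h , target a h , branches a , false)) []

  -- The value moves from D to D₂ while it is added, so that the table can be restored afterwards.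
  -- The digits of the sum pile up on A₂ in reverse order.
  addStep : Context → Bool → Maybe Bit → Maybe Bit → Maybe StackActionᴾ
  addStep x k nothing  nothing   = to (turnA₂ x) (if k then A₂ˢ ↦ push (bt (suc zero)) ∷ [] else [])
  addStep x k nothing  (just b′) = let r , k′ = addBit k zero b′ in
    to (add (x , k′)) (Aˢ ↦ pop ∷ A₂ˢ ↦ push (bt r) ∷ [])
  addStep x k (just b) nothing   = let r , k′ = addBit k b zero in
    to (add (x , k′)) (Dˢ ↦ pop ∷ D₂ˢ ↦ push (bt b) ∷ A₂ˢ ↦ push (bt r) ∷ [])
  addStep x k (just b) (just b′) = let r , k′ = addBit k b b′ in
    to (add (x , k′)) (Dˢ ↦ pop ∷ D₂ˢ ↦ push (bt b) ∷ Aˢ ↦ pop ∷ A₂ˢ ↦ push (bt r) ∷ [])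

  resolve : Context → Maybe StackActionᴾ
  resolve (h , t , _     , false) = to (saveP (h , t)) []
  resolve (h , t , true  , true)  = to (scan (h , other t , false , false)) []
  resolve (h , t , false , true)  = to (turnA h) []

  δᴾ : Control → Maybe InputSymbol → Vec (Maybe Γ) 9 → Maybe StackActionᴾ
  δᴾ q r (s ∷ p ∷ p₂ ∷ q′ ∷ q₂ ∷ d ∷ d₂ ∷ a ∷ a₂ ∷ []) = go q
    where
    go : Control → Maybe StackActionᴾ
    go (boot false) = to (boot true) (Sˢ ↦ push (col startColumn) ∷ Dˢ ↦ push (col startColumn) ∷ [])
    go (boot true)  = to main (Sˢ ↦ push (hdr (start , nothing)) ∷ Dˢ ↦ push (hdr (start , nothing)) ∷ [])
    go main = maybe′ (λ h → to (load (h , noCurrent)) (Sˢ ↦ pop ∷ [])) (to (out zero) []) (asHeader s)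
    go (load (h , cur)) = maybe′
      (λ c → just (act (load (h , collect cur c)) (push (addressCell c)) (ops (Sˢ ↦ pop ∷ Pˢ ↦ push (col c) ∷ [])) nothing))
      -- With the columns exhausted, the address stack holds the whole address, so `r` is now the
      -- input symbol that N scans.
      (to (update ((h , r , cur) , blankColumn , blankColumn)) []) (asColumn s)
    go (update (v , c , c′)) = maybe′
      -- The address stack is emptied along the way, one cell per column.
      (λ l → just (act (update (v , l , c)) pop
        (ops (Pˢ ↦ pop ∷ P₂ˢ ↦ push (col l) ∷ Qˢ ↦ newOp (decide v) (just l) c c′ q′ ∷ [])) nothing))
      (to (turnP v) (Qˢ ↦ newOp (decide v) nothing c c′ q′ ∷ [])) (asColumn p)
    go (turnP v) = maybe′ (λ x → to (turnP v) (P₂ˢ ↦ pop ∷ Pˢ ↦ push x ∷ [])) (startLookups (proj₁ v) (decide v)) p₂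
    go (scan x@(_ , t , _)) = maybe′
      (λ h → to (check (x , does (h ≟ʰ t))) (Dˢ ↦ pop ∷ D₂ˢ ↦ push (hdr h) ∷ [])) (to (back x) []) (asHeader d)
    go (check (x , e)) = maybe′
      (λ c → maybe′ (λ c′ → to (check (x , e ∧ does (c ≟ᶜ c′))) (Dˢ ↦ pop ∷ D₂ˢ ↦ push (col c) ∷ Qˢ ↦ pop ∷ Q₂ˢ ↦ push (col c′) ∷ []))
                    (to (check (x , false)) (Dˢ ↦ pop ∷ D₂ˢ ↦ push (col c) ∷ [])) (asColumn q′))
      (to (turnQ₂ (x , maybe′ (λ _ → false) e (asColumn q′))) []) (asColumn d)
    go (turnQ₂ (x@(h , t , m , f) , e)) = maybe′ (λ y → to (turnQ₂ (x , e)) (Q₂ˢ ↦ pop ∷ Qˢ ↦ push y ∷ []))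
      (if e then to (add ((h , t , m , true) , false)) [] else to (skip x) []) q₂
    go (skip x) = maybe′ (λ b → to (skip x) (Dˢ ↦ pop ∷ D₂ˢ ↦ push (bt b) ∷ [])) (to (scan x) []) (asBit d)
    go (add (x , k)) = addStep x k (asBit d) (asBit a)
    go (turnA₂ x) = maybe′ (λ y → to (turnA₂ x) (A₂ˢ ↦ pop ∷ Aˢ ↦ push y ∷ [])) (to (scan x) []) a₂
    go (back x) = maybe′ (λ y → to (back x) (D₂ˢ ↦ pop ∷ Dˢ ↦ push y ∷ [])) (resolve x) d₂
    go (saveP (h , t)) = maybe′ (λ y → to (saveP (h , t)) (Pˢ ↦ pop ∷ Sˢ ↦ push y ∷ [])) (to (turnQ t) (Sˢ ↦ push (hdr h) ∷ [])) p
    go (turnQ t) = maybe′ (λ y → to (turnQ t) (Qˢ ↦ pop ∷ Q₂ˢ ↦ push y ∷ [])) (to (saveQ t) []) q′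
    -- The successor is copied to both places at once: to the top of S, and into the table as an
    -- entry without value bits.
    go (saveQ t) = maybe′ (λ y → to (saveQ t) (Q₂ˢ ↦ pop ∷ Sˢ ↦ push y ∷ Dˢ ↦ push y ∷ []))
      (to clean (Sˢ ↦ push (hdr t) ∷ Dˢ ↦ push (hdr t) ∷ [])) q₂
    go (turnA h) = maybe′ (λ y → to (turnA h) (Aˢ ↦ pop ∷ A₂ˢ ↦ push y ∷ [])) (to (putA h) []) a
    go (putA h) = maybe′ (λ y → to (putA h) (A₂ˢ ↦ pop ∷ Dˢ ↦ push y ∷ [])) (to (putP h) []) a₂
    go (putP h) = maybe′ (λ y → to (putP h) (Pˢ ↦ pop ∷ Dˢ ↦ push y ∷ [])) (to clean (Dˢ ↦ push (hdr h) ∷ [])) p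
    go clean = maybe′ (λ _ → to clean (Aˢ ↦ pop ∷ [])) (maybe′ (λ _ → to clean (Qˢ ↦ pop ∷ [])) (to main []) q′) a
    go (out zero) = to (out (suc zero)) (Dˢ ↦ pop ∷ [])
    go (out (suc zero)) = maybe′ (λ _ → to (out (suc zero)) (Dˢ ↦ pop ∷ []))
      -- If no bit follows the key, the value is zero and its numeral is the single digit 0.
      (maybe′ (λ _ → to (out (suc (suc zero))) []) (just (act (out (suc (suc (suc zero)))) keep (ops []) (just zero))) (asBit d))
      (asColumn d)
    go (out (suc (suc zero))) = maybe′ (λ b → just (act (out (suc (suc zero))) keep (ops (Dˢ ↦ pop ∷ [])) (just b)))
      (to (out (suc (suc (suc zero)))) []) (asBit d)
    go (out (suc (suc (suc zero)))) = nothing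

  abstract
    finite-Context : Finite Context
    finite-Context = finite-× finite-Header (finite-× finite-Header (finite-× finite-Bool finite-Bool))

    finite-Control : Finite Control
    finite-Control =
      finite-⊎ finite-Bool (finite-⊎ finite-⊤ (finite-⊎ (finite-× finite-Header finite-Current)
      (finite-⊎ (finite-× finite-View (finite-× finite-Column finite-Column)) (finite-⊎ finite-View
      (finite-⊎ finite-Context (finite-⊎ (finite-× finite-Context finite-Bool) (finite-⊎ (finite-× finite-Context finite-Bool)
      (finite-⊎ finite-Context (finite-⊎ (finite-× finite-Context finite-Bool) (finite-⊎ finite-Context
      (finite-⊎ finite-Context (finite-⊎ (finite-× finite-Header finite-Header) (finite-⊎ finite-Header (finite-⊎ finite-Header
      (finite-⊎ finite-Header (finite-⊎ finite-Header (finite-⊎ finite-Header (finite-⊎ finite-⊤ finite-Fin))))))))))))))))))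

    finite-Γ : Finite Γ
    finite-Γ = finite-⊎ finite-Header (finite-⊎ finite-Column finite-Fin)

  program : StackMachine
  program = record
    { Control = Control ; Symbol = Γ ; finiteControl = finite-Control ; finiteSymbol = finite-Γ
    ; stacks = 9 ; start = boot false ; δ = δᴾ }

  open Stack program public renaming (machine to machineᴾ)

  stacksᴾ : (s p p₂ q q₂ d d₂ a a₂ : List Γ) → Vec (List Γ) 9
  stacksᴾ s p p₂ q q₂ d d₂ a a₂ = s ∷ p ∷ p₂ ∷ q ∷ q₂ ∷ d ∷ d₂ ∷ a ∷ a₂ ∷ []

  -- Runs of the program and their costs

  module Run (i : Instance) where
    open Search N once i

    load-run : ∀ w {rest h cur as p p₂ q q₂ d d₂ a a₂ o} →
      i ⊢ config (load (h , cur)) as (stacksᴾ (map col w ++ rest) p p₂ q q₂ d d₂ a a₂) o ⟶[ length w ]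
          config (load (h , foldl collect cur w)) (map addressCell w ʳ++ as) (stacksᴾ rest (map col w ʳ++ p) p₂ q q₂ d d₂ a a₂) o
    load-run []      = done
    load-run (c ∷ w) = step refl (load-run w)

    turnP-run : ∀ xs {v as s p q q₂ d d₂ a a₂ o} →
      i ⊢ config (turnP v) as (stacksᴾ s p xs q q₂ d d₂ a a₂) o ⟶[ length xs ]
          config (turnP v) as (stacksᴾ s (xs ʳ++ p) [] q q₂ d d₂ a a₂) o
    turnP-run []       = done
    turnP-run (x ∷ xs) = step refl (turnP-run xs)

    newStep : Maybe NAction → Maybe Column → Column → Column → List Column → List Column
    newStep nothing  l c r q = q
    newStep (just a) l c r q = trim∷ (newColumn a l c r) q

    newOp-correct : ∀ m l c r q → apply (newOp m l c r (head (map col q))) (map col q) ≡ map col (newStep m l c r q)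
    newOp-correct nothing  l c r q       = refl
    newOp-correct (just a) l c r (_ ∷ _) = refl
    newOp-correct (just a) l c r []      with does (newColumn a l c r ≟ᶜ blankColumn)
    ... | true  = refl
    ... | false = refl

    -- The sweep takes place whether or not N halts; in the halting case it writes nothing and Q
    -- stays empty.
    updated : Maybe NAction → Column → Column → List Column → List Column → List Column
    updated m c r []       q = newStep m nothing c r q
    updated m c r (l ∷ ps) q = updated m l c ps (newStep m (just l) c r q)

    updated-nothing : ∀ c r ps q → updated nothing c r ps q ≡ q
    updated-nothing c r []       q = refl
    updated-nothing c r (l ∷ ps) q = updated-nothing l c ps q

    updated-just : ∀ a c r ps q → updated (just a) c r ps q ≡ rewriteFrom a c r ps q
    updated-just a c r []       q = refl
    updated-just a c r (l ∷ ps) q = updated-just a l c ps _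

    update-run : ∀ ps {v c r} q {as s p₂ q₂ d d₂ a a₂ o} → length as ≡ length ps →
      i ⊢ config (update (v , c , r)) as (stacksᴾ s (map col ps) p₂ (map col q) q₂ d d₂ a a₂) o ⟶[ suc (length ps) ]
          config (turnP v) [] (stacksᴾ s [] (map col ps ʳ++ p₂) (map col (updated (decide v) c r ps q)) q₂ d d₂ a a₂) o
    update-run [] {v} {c} {r} q {[]} {s} {p₂} {q₂} {d} {d₂} {a} {a₂} {o} e = step refl
      (subst (λ Q → i ⊢ config (turnP v) [] (stacksᴾ s [] p₂ Q q₂ d d₂ a a₂) o ⟶[ 0 ]
                        config (turnP v) [] (stacksᴾ s [] p₂ (map col (newStep (decide v) nothing c r q)) q₂ d d₂ a a₂) o)
        (sym (newOp-correct (decide v) nothing c r q)) done)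
    update-run (l ∷ ps) {v} {c} {r} q {_ ∷ as} {s} {p₂} {q₂} {d} {d₂} {a} {a₂} {o} e = step refl
      (subst (λ Q → i ⊢ config (update (v , l , c)) as (stacksᴾ s (map col ps) (col l ∷ p₂) Q q₂ d d₂ a a₂) o ⟶[ suc (length ps) ]
                        config (turnP v) [] (stacksᴾ s [] (map col ps ʳ++ col l ∷ p₂) (map col (updated (decide v) c r (l ∷ ps) q)) q₂ d d₂ a a₂) o)
        (sym (newOp-correct (decide v) (just l) c r q))
        (update-run ps (newStep (decide v) (just l) c r q) (suc-injective e)))

    turnQ₂-run : ∀ xs {x e as s p p₂ q d d₂ a a₂ o} →
      i ⊢ config (turnQ₂ (x , e)) as (stacksᴾ s p p₂ q xs d d₂ a a₂) o ⟶[ length xs ]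
          config (turnQ₂ (x , e)) as (stacksᴾ s p p₂ (xs ʳ++ q) [] d d₂ a a₂) o
    turnQ₂-run []       = done
    turnQ₂-run (x ∷ xs) = step refl (turnQ₂-run xs)

    -- Each column of `w` costs one step of comparison and moves at most one column to Q₂, which
    -- costs a second step when Q is restored.
    check-run : ∀ w qs qs₂ {x e rest as s p p₂ d₂ a a₂ o} → asColumn (head rest) ≡ nothing →
      i ⊢ config (check (x , e)) as (stacksᴾ s p p₂ (map col qs) qs₂ (map col w ++ rest) d₂ a a₂) o ⟶[ length w + length w + suc (length qs₂) ]
          config (turnQ₂ (x , matchColumns e w qs)) as (stacksᴾ s p p₂ (qs₂ ʳ++ map col qs) [] rest (map col w ʳ++ d₂) a a₂) o
    check-run []      []       qs₂ n = step (cong (maybe′ _ _) n) (turnQ₂-run qs₂)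
    check-run []      (q ∷ qs) qs₂ n = step (cong (maybe′ _ _) n) (turnQ₂-run qs₂)
    check-run (c ∷ w) []       qs₂ n = step refl (weaken (+-monoˡ-≤ _ (+-monoʳ-≤ (length w) (n≤1+n _))) (check-run w [] qs₂ n))
    check-run (c ∷ w) (q ∷ qs) qs₂ n = step refl (weaken (≤-reflexive
      (trans (+-suc (length w + length w) _) (cong (_+ suc (length qs₂)) (sym (+-suc (length w) (length w))))))
      (check-run w qs (col q ∷ qs₂) n))

    skip-run : ∀ v {x rest as s p p₂ q q₂ d₂ a a₂ o} →
      i ⊢ config (skip x) as (stacksᴾ s p p₂ q q₂ (map bt v ++ rest) d₂ a a₂) o ⟶[ length v ]
          config (skip x) as (stacksᴾ s p p₂ q q₂ rest (map bt v ʳ++ d₂) a a₂) o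
    skip-run []      = done
    skip-run (b ∷ v) = step refl (skip-run v)

    add-run : ∀ k v bs {x rest as s p p₂ q q₂ d₂ a₂ o} → asBit (head rest) ≡ nothing →
      i ⊢ config (add (x , k)) as (stacksᴾ s p p₂ q q₂ (map bt v ++ rest) d₂ (map bt bs) a₂) o ⟶[ suc (length v + length bs) ]
          config (turnA₂ x) as (stacksᴾ s p p₂ q q₂ rest (map bt v ʳ++ d₂) [] (map bt (addBits k v bs) ʳ++ a₂)) o
    add-run false []      []       {x} n = step (cong (λ m → addStep x false m nothing) n) done
    add-run true  []      []       {x} n = step (cong (λ m → addStep x true m nothing) n) done
    add-run k     []      (b ∷ bs) {x} n = step (cong (λ m → addStep x k m (just b)) n) (add-run _ [] bs n)
    add-run k     (b ∷ v) []       n = step refl (add-run _ v [] n)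
    add-run k     (b ∷ v) (b′ ∷ bs) n = step refl
      (weaken (s≤s (+-monoʳ-≤ (length v) (n≤1+n _))) (add-run _ v bs n))

    turnA₂-run : ∀ xs {x as s p p₂ q q₂ d d₂ a o} →
      i ⊢ config (turnA₂ x) as (stacksᴾ s p p₂ q q₂ d d₂ a xs) o ⟶[ length xs ]
          config (turnA₂ x) as (stacksᴾ s p p₂ q q₂ d d₂ (xs ʳ++ a) []) o
    turnA₂-run []       = done
    turnA₂-run (x ∷ xs) = step refl (turnA₂-run xs)

    back-run : ∀ xs {x as s p p₂ q q₂ d a a₂ o} →
      i ⊢ config (back x) as (stacksᴾ s p p₂ q q₂ d xs a a₂) o ⟶[ length xs ]
          config (back x) as (stacksᴾ s p p₂ q q₂ (xs ʳ++ d) [] a a₂) o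
    back-run []       = done
    back-run (x ∷ xs) = step refl (back-run xs)

    saveP-run : ∀ xs {h t as s p₂ q q₂ d d₂ a a₂ o} →
      i ⊢ config (saveP (h , t)) as (stacksᴾ s xs p₂ q q₂ d d₂ a a₂) o ⟶[ length xs ]
          config (saveP (h , t)) as (stacksᴾ (xs ʳ++ s) [] p₂ q q₂ d d₂ a a₂) o
    saveP-run []       = done
    saveP-run (x ∷ xs) = step refl (saveP-run xs)

    turnQ-run : ∀ xs {t as s p p₂ q₂ d d₂ a a₂ o} →
      i ⊢ config (turnQ t) as (stacksᴾ s p p₂ xs q₂ d d₂ a a₂) o ⟶[ length xs ]
          config (turnQ t) as (stacksᴾ s p p₂ [] (xs ʳ++ q₂) d d₂ a a₂) o
    turnQ-run []       = done
    turnQ-run (x ∷ xs) = step refl (turnQ-run xs)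

    saveQ-run : ∀ xs {t as s p p₂ q d d₂ a a₂ o} →
      i ⊢ config (saveQ t) as (stacksᴾ s p p₂ q xs d d₂ a a₂) o ⟶[ length xs ]
          config (saveQ t) as (stacksᴾ (xs ʳ++ s) p p₂ q [] (xs ʳ++ d) d₂ a a₂) o
    saveQ-run []       = done
    saveQ-run (x ∷ xs) = step refl (saveQ-run xs)

    turnA-run : ∀ xs {h as s p p₂ q q₂ d d₂ a₂ o} →
      i ⊢ config (turnA h) as (stacksᴾ s p p₂ q q₂ d d₂ xs a₂) o ⟶[ length xs ]
          config (turnA h) as (stacksᴾ s p p₂ q q₂ d d₂ [] (xs ʳ++ a₂)) o
    turnA-run []       = done
    turnA-run (x ∷ xs) = step refl (turnA-run xs)

    putA-run : ∀ xs {h as s p p₂ q q₂ d d₂ a o} →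
      i ⊢ config (putA h) as (stacksᴾ s p p₂ q q₂ d d₂ a xs) o ⟶[ length xs ]
          config (putA h) as (stacksᴾ s p p₂ q q₂ (xs ʳ++ d) d₂ a []) o
    putA-run []       = done
    putA-run (x ∷ xs) = step refl (putA-run xs)

    putP-run : ∀ xs {h as s p₂ q q₂ d d₂ a a₂ o} →
      i ⊢ config (putP h) as (stacksᴾ s xs p₂ q q₂ d d₂ a a₂) o ⟶[ length xs ]
          config (putP h) as (stacksᴾ s [] p₂ q q₂ (xs ʳ++ d) d₂ a a₂) o
    putP-run []       = done
    putP-run (x ∷ xs) = step refl (putP-run xs)

    clean-run : ∀ a q {as s p p₂ q₂ d d₂ a₂ o} →
      i ⊢ config clean as (stacksᴾ s p p₂ q q₂ d d₂ a a₂) o ⟶[ suc (length a + length q) ]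
          config main as (stacksᴾ s p p₂ [] q₂ d d₂ [] a₂) o
    clean-run []       []       = step refl done
    clean-run []       (x ∷ xs) = step refl (clean-run [] xs)
    clean-run (x ∷ xs) q        = step refl (clean-run xs q)

    out₁-run : ∀ w {as s p p₂ q q₂ rest d₂ a a₂ o} →
      i ⊢ config (out (suc zero)) as (stacksᴾ s p p₂ q q₂ (map col w ++ rest) d₂ a a₂) o ⟶[ length w ]
          config (out (suc zero)) as (stacksᴾ s p p₂ q q₂ rest d₂ a a₂) o
    out₁-run []      = done
    out₁-run (c ∷ w) = step refl (out₁-run w)

    out₂-run : ∀ v {as s p p₂ q q₂ rest d₂ a a₂ o} → asBit (head rest) ≡ nothing →
      i ⊢ config (out (suc (suc zero))) as (stacksᴾ s p p₂ q q₂ (map bt v ++ rest) d₂ a a₂) o ⟶[ suc (length v) ]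
          config (out (suc (suc (suc zero)))) as (stacksᴾ s p p₂ q q₂ rest d₂ a a₂) (o ++ v)
    out₂-run []      {o = o} n = step (cong (maybe′ _ _) n) (subst (λ o′ → i ⊢ config (out (suc (suc (suc zero)))) _ _ o ⟶[ 0 ] config _ _ _ o′)
      (sym (++-identityʳ o)) done)
    out₂-run (b ∷ v) {o = o} n = step refl
      (subst (λ o′ → i ⊢ config (out (suc (suc zero))) _ _ (o ∷ʳ b) ⟶[ suc (length v) ] config (out (suc (suc (suc zero)))) _ _ o′)
        (++-assoc o (b ∷ []) v) (out₂-run v n))

    bitsᴸ : List Bit → List Γ
    bitsᴸ = map bt

    columnsᴸ : List Column → List Γ
    columnsᴸ = map col

    encodeStack : List Conf → List Γ
    encodeStack []            = []
    encodeStack ((h , w) ∷ S) = hdr h ∷ map col w ++ encodeStack S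

    encodeTable : List Entry → List Γ
    encodeTable []                  = []
    encodeTable (((h , w) , v) ∷ D) = hdr h ∷ map col w ++ map bt v ++ encodeTable D

    encodeRev : List Entry → List Γ → List Γ
    encodeRev []                  d = d
    encodeRev (((h , w) , v) ∷ D) d = encodeRev D (map bt v ʳ++ map col w ʳ++ hdr h ∷ d)

    encodeRev-correct : ∀ D d → encodeRev D d ≡ encodeTable D ʳ++ d
    encodeRev-correct []                  d = refl
    encodeRev-correct (((h , w) , v) ∷ D) d = trans (encodeRev-correct D _)
      (sym (trans (++-ʳ++ (map col w)) (++-ʳ++ (map bt v))))

    stack-noColumn : ∀ S → asColumn (head (encodeStack S)) ≡ nothing
    stack-noColumn []      = refl
    stack-noColumn (_ ∷ _) = refl

    table-noColumn : ∀ v D → asColumn (head (map bt v ++ encodeTable D)) ≡ nothing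
    table-noColumn []      []      = refl
    table-noColumn []      (_ ∷ _) = refl
    table-noColumn (_ ∷ _) _       = refl

    table-noBit : ∀ D → asBit (head (encodeTable D)) ≡ nothing
    table-noBit []      = refl
    table-noBit (_ ∷ _) = refl

    module Lookup (s p : List Γ) (qs : List Column) (h t : Header) (m : Bool) where

      at-scan : Bool → List Γ → List Γ → List Bit → Config
      at-scan f d d₂ A = config (scan (h , t , m , f)) [] (stacksᴾ s p [] (map col qs) [] d d₂ (map bt A) []) []

      restore : ∀ (bs : List Bit) → (bitsᴸ bs ʳ++ []) ʳ++ [] ≡ bitsᴸ bs
      restore bs = trans (ʳ++-ʳ++ (bitsᴸ bs)) (++-identityʳ _)

      value-run : ∀ {W} f e v D A d₂ → length v ≤ W → length A ≤ W →
        i ⊢ config (turnQ₂ ((h , t , m , f) , e)) [] (stacksᴾ s p [] (map col qs) [] (map bt v ++ encodeTable D) d₂ (map bt A) []) []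
          ⟶[ 4 + 3 * W ] at-scan (f ∨ e) (encodeTable D) (map bt v ʳ++ d₂) (if e then addBits false v A else A)
      value-run {W} f false v D A d₂ v≤ A≤ =
        ends (cong (λ g → at-scan g (encodeTable D) (map bt v ʳ++ d₂) A) (sym (∨-identityʳ f)))
          (weaken cost (step refl (skip-run v ▷ one-step (cong (maybe′ _ _) (table-noBit D)))))
        where
        cost : suc (length v + 1) ≤ 4 + 3 * W
        cost = s≤s (≤-trans (≤-reflexive (+-comm _ 1)) (s≤s (m≤n⇒m≤1+n (m≤n⇒m≤1+n (≤-trans v≤ (m≤m+n W _))))))
      value-run {W} f true v D A d₂ v≤ A≤ =
        ends (cong₂ (λ g x → config (scan (h , t , m , g)) [] (stacksᴾ s p [] (map col qs) [] (encodeTable D) (map bt v ʳ++ d₂) x []) [])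
            (sym (∨-zeroʳ f)) (restore (addBits false v A)))
          (weaken cost (step refl (add-run false v A (table-noBit D) ▷ turnA₂-run (bitsᴸ (addBits false v A) ʳ++ []) ▷ one-step refl)))
        where
        sum≤ : length (bitsᴸ (addBits false v A) ʳ++ []) ≤ suc W
        sum≤ = ≤-trans (≤-reflexive (trans (length-ʳ++ (bitsᴸ (addBits false v A)))
          (trans (+-identityʳ _) (length-map bt (addBits false v A)))))
          (≤-trans (addBits-length false v A) (s≤s (⊔-lub v≤ A≤)))
        cost : suc (suc (length v + length A) + (length (bitsᴸ (addBits false v A) ʳ++ []) + 1)) ≤ 4 + 3 * W
        cost = ≤-trans (s≤s (+-mono-≤ (s≤s (+-mono-≤ v≤ A≤)) (+-monoˡ-≤ 1 sum≤)))
          (≤-reflexive (solve 1 (λ w → con 1 :+ (con 1 :+ (w :+ w) :+ (con 1 :+ w :+ con 1)) := con 4 :+ con 3 :* w) refl W))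
          where open +-*-Solver

      -- `j` counts the additions that may already have gone into `A`. Passing an entry moves one
      -- unit from `length D` to `j`, so the last hypothesis is preserved.
      scan-run : ∀ {W G} j f D A d₂ → All (λ e → length (proj₂ (proj₁ e)) ≤ W × length (proj₂ e) ≤ G) D →
        length A ≤ G + j → G + (length D + j) ≤ W →
        i ⊢ at-scan f (encodeTable D) d₂ A ⟶[ length D * entryCost W ]
            at-scan (member (t , qs) D f) [] (encodeRev D d₂) (collectValues (t , qs) D A)
      scan-run j f []                     A d₂ []                 A≤ room = done
      scan-run {W} {G} j f (((h′ , w) , v) ∷ D) A d₂ ((w≤ , v≤) ∷ es) A≤ room =
        weaken cost (step refl (check-run w qs [] (table-noColumn v D)
          ▷ value-run f hit v D A (map col w ʳ++ hdr h′ ∷ d₂) v≤W A≤W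
          ▷ scan-run (suc j) (f ∨ hit) D (if hit then addBits false v A else A) _ es (A′≤ hit)
              (≤-trans (≤-reflexive (cong (G +_) (+-suc (length D) j))) room)))
        where
        hit : Bool
        hit = match (h′ , w) (t , qs)
        v≤W : length v ≤ W
        v≤W = ≤-trans v≤ (m+n≤o⇒m≤o G room)
        A≤W : length A ≤ W
        A≤W = ≤-trans A≤ (≤-trans (+-monoʳ-≤ G (m≤n+m j _)) room)
        A′≤ : ∀ b → length (if b then addBits false v A else A) ≤ G + suc j
        A′≤ false = ≤-trans A≤ (+-monoʳ-≤ G (n≤1+n j))
        A′≤ true  = ≤-trans (addBits-length false v A) (≤-trans (s≤s (⊔-lub (≤-trans v≤ (m≤m+n G j)) A≤)) (≤-reflexive (sym (+-suc G j))))
        cost : suc (length w + length w + 1 + (4 + 3 * W + length D * entryCost W)) ≤ entryCost W + length D * entryCost W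
        cost = ≤-trans (s≤s (+-monoˡ-≤ _ (+-monoˡ-≤ 1 (+-mono-≤ w≤ w≤))))
          (≤-reflexive (solve 2 (λ w d → con 1 :+ (w :+ w :+ con 1 :+ (con 4 :+ con 3 :* w :+ d)) := con 6 :+ con 5 :* w :+ d) refl W (length D * entryCost W)))
          where open +-*-Solver

      table-length : ∀ {W} D → All (λ e → length (proj₂ (proj₁ e)) ≤ W × length (proj₂ e) ≤ W) D →
        length (encodeTable D) ≤ length D * suc (W + W)
      table-length []                  []                 = z≤n
      table-length {W} (((h , w) , v) ∷ D) ((w≤ , v≤) ∷ es) = s≤s (≤-trans (≤-reflexive
        (trans (length-++ (columnsᴸ w)) (cong₂ _+_ (length-map col w)
        (trans (length-++ (bitsᴸ v)) (cong (_+ length (encodeTable D)) (length-map bt v))))))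
        (≤-trans (+-mono-≤ w≤ (+-mono-≤ v≤ (table-length D es))) (≤-reflexive (sym (+-assoc W W _)))))

      lookup-run : ∀ {W G} j D A → All (λ e → length (proj₂ (proj₁ e)) ≤ W × length (proj₂ e) ≤ G) D →
        length A ≤ G + j → G + (length D + j) ≤ W →
        i ⊢ at-scan false (encodeTable D) [] A ⟶[ lookupCost W ]
            config (back (h , t , m , member (t , qs) D false)) []
              (stacksᴾ s p [] (map col qs) [] (encodeTable D) [] (map bt (collectValues (t , qs) D A)) []) []
      lookup-run {W} {G} j D A es A≤ room = weaken cost (ends
        (cong (λ d → config (back (h , t , m , member (t , qs) D false)) [] (stacksᴾ s p [] (map col qs) [] d [] (map bt (collectValues (t , qs) D A)) []) [])
          (trans (cong (_ʳ++ []) (encodeRev-correct D [])) (trans (ʳ++-ʳ++ (encodeTable D)) (++-identityʳ _))))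
        (scan-run j false D A [] es A≤ room ▷ step refl (back-run (encodeRev D []))))
        where
        D≤W : length D ≤ W
        D≤W = ≤-trans (m≤m+n _ j) (m+n≤o⇒n≤o G room)
        rev≤ : length (encodeRev D []) ≤ W * suc (W + W)
        rev≤ = ≤-trans (≤-reflexive (trans (cong length (encodeRev-correct D [])) (trans (length-ʳ++ (encodeTable D)) (+-identityʳ _))))
          (≤-trans (table-length D (All.map (λ (w≤ , v≤) → w≤ , ≤-trans v≤ (m+n≤o⇒m≤o G room)) es)) (*-monoˡ-≤ _ D≤W))
        cost : length D * entryCost W + suc (length (encodeRev D [])) ≤ lookupCost W
        cost = +-mono-≤ (*-monoˡ-≤ _ D≤W) (s≤s rev≤)

    mainAt : SearchState → Config
    mainAt (S , D) = config main [] (stacksᴾ (encodeStack S) [] [] [] [] (encodeTable D) [] [] []) []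

    readyAt : Control → Conf → List Conf → List Entry → List Column → List Bit → Config
    readyAt k (_ , w) S D q A = config k []
      (stacksᴾ (encodeStack S) (columnsᴸ w ʳ++ []) [] (columnsᴸ q) [] (encodeTable D) [] (bitsᴸ A) []) []

    ʳ++-twice : ∀ {X : Set} (xs : List X) {ys} → (xs ʳ++ []) ʳ++ ys ≡ xs ++ ys
    ʳ++-twice xs = ʳ++-ʳ++ xs

    length-rev : ∀ {X : Set} (xs : List X) → length (xs ʳ++ []) ≡ length xs
    length-rev xs = trans (length-ʳ++ xs) (+-identityʳ _)

    rewriteBy : Maybe NAction → List Column → List Column
    rewriteBy m w = updated m blankColumn blankColumn (w ʳ++ []) []

    load-phase : ∀ {W} h w S D → length w ≤ W → let v = view i (h , w) in
      i ⊢ mainAt ((h , w) ∷ S , D) ⟶[ 3 + 3 * W ] readyAt (turnP v) (h , w) S D (rewriteBy (decide v) w) []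
    load-phase {W} h w S D w≤ = weaken cost (step refl (load-run w
      ▷ ends (cong₂ (λ k p → config (update k) (map addressCell w ʳ++ []) (stacksᴾ (encodeStack S) p [] [] [] (encodeTable D) [] [] []) [])
               (cong (λ as → (h , symbolAt i as , foldl collect noCurrent w) , blankColumn , blankColumn) addr≡)
               (sym (map-ʳ++ col w)))
             (one-step (cong (maybe′ _ _) (stack-noColumn S)))
      ▷ ends (cong (λ p → config (turnP (view i (h , w))) [] (stacksᴾ (encodeStack S) [] p (columnsᴸ q) [] (encodeTable D) [] [] []) []) cols≡)
             (update-run (w ʳ++ []) [] (trans (length-rev (map addressCell w)) (trans (length-map addressCell w) (sym (length-rev w)))))
      ▷ turnP-run (columnsᴸ w)))
      where
      q = rewriteBy (decide (view i (h , w))) w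
      addr≡ : (map addressCell w ʳ++ []) ʳ++ [] ≡ map addressCell w
      addr≡ = trans (ʳ++-twice (map addressCell w)) (++-identityʳ _)
      cols≡ : columnsᴸ (w ʳ++ []) ʳ++ [] ≡ columnsᴸ w
      cols≡ = trans (cong (_ʳ++ []) (map-ʳ++ col w)) (trans (ʳ++-twice (columnsᴸ w)) (++-identityʳ _))
      cost : suc (length w + (1 + (suc (length (w ʳ++ [])) + length (columnsᴸ w)))) ≤ 3 + 3 * W
      cost = ≤-trans (s≤s (+-mono-≤ w≤ (s≤s (s≤s (+-mono-≤ (≤-trans (≤-reflexive (length-rev w)) w≤) (≤-trans (≤-reflexive (length-map col w)) w≤))))))
        (≤-reflexive (solve 1 (λ w → con 1 :+ (w :+ (con 1 :+ (con 1 :+ (w :+ w)))) := con 3 :+ con 3 :* w) refl W))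
        where open +-*-Solver

    finish-run : ∀ {W} h w S D q A → length w ≤ W → length q ≤ W → length A ≤ W →
      i ⊢ readyAt (turnA h) (h , w) S D q A ⟶[ 4 + 4 * W ] mainAt (finish (h , w) A S D)
    finish-run {W} h w S D q A w≤ q≤ A≤ = weaken cost (turnA-run (bitsᴸ A) ▷ step refl
      (ends (cong (λ d → config (putA h) [] (stacksᴾ (encodeStack S) (columnsᴸ w ʳ++ []) [] (columnsᴸ q) [] d [] [] []) []) (ʳ++-twice (bitsᴸ A)))
        (putA-run (bitsᴸ A ʳ++ [])) ▷ step refl
      (ends (cong (λ d → config (putP h) [] (stacksᴾ (encodeStack S) [] [] (columnsᴸ q) [] d [] [] []) []) (ʳ++-twice (columnsᴸ w)))
        (putP-run (columnsᴸ w ʳ++ [])) ▷ step refl (clean-run [] (columnsᴸ q)))))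
      where
      rev≤ : ∀ {X Y : Set} (f : X → Y) xs → length xs ≤ W → length (map f xs ʳ++ []) ≤ W
      rev≤ f xs l = ≤-trans (≤-reflexive (trans (length-rev (map f xs)) (length-map f xs))) l
      cost : length (bitsᴸ A) + suc (length (bitsᴸ A ʳ++ []) + suc (length (columnsᴸ w ʳ++ []) + suc (suc (length (columnsᴸ q))))) ≤ 4 + 4 * W
      cost = ≤-trans (+-mono-≤ (≤-trans (≤-reflexive (length-map bt A)) A≤) (s≤s (+-mono-≤ (rev≤ bt A A≤) (s≤s (+-mono-≤ (rev≤ col w w≤)
          (s≤s (s≤s (≤-trans (≤-reflexive (length-map col q)) q≤))))))))
        (≤-reflexive (solve 1 (λ w → w :+ (con 1 :+ (w :+ (con 1 :+ (w :+ (con 2 :+ w))))) := con 4 :+ con 4 :* w) refl W))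
        where open +-*-Solver

    launch-run : ∀ {W} h w S D t q A → length w ≤ W → length q ≤ W → length A ≤ W →
      i ⊢ readyAt (saveP (h , t)) (h , w) S D q A ⟶[ 4 + 4 * W ] mainAt (launch (t , q) ((h , w) ∷ S) D)
    launch-run {W} h w S D t q A w≤ q≤ A≤ = weaken cost
      (ends (cong (λ s → config (saveP (h , t)) [] (stacksᴾ s [] [] (columnsᴸ q) [] (encodeTable D) [] (bitsᴸ A) []) []) (ʳ++-twice (columnsᴸ w)))
        (saveP-run (columnsᴸ w ʳ++ [])) ▷ step refl (turnQ-run (columnsᴸ q) ▷ step refl
      (ends (cong₂ (λ s d → config (saveQ t) [] (stacksᴾ s [] [] [] [] d [] (bitsᴸ A) []) []) (ʳ++-twice (columnsᴸ q)) (ʳ++-twice (columnsᴸ q)))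
        (saveQ-run (columnsᴸ q ʳ++ [])) ▷ step refl (clean-run (bitsᴸ A) []))))
      where
      rev≤ : ∀ {X Y : Set} (f : X → Y) xs → length xs ≤ W → length (map f xs ʳ++ []) ≤ W
      rev≤ f xs l = ≤-trans (≤-reflexive (trans (length-rev (map f xs)) (length-map f xs))) l
      cost : length (columnsᴸ w ʳ++ []) + suc (length (columnsᴸ q) + suc (length (columnsᴸ q ʳ++ []) + suc (suc (length (bitsᴸ A) + 0)))) ≤ 4 + 4 * W
      cost = ≤-trans (+-mono-≤ (rev≤ col w w≤) (s≤s (+-mono-≤ (≤-trans (≤-reflexive (length-map col q)) q≤) (s≤s (+-mono-≤ (rev≤ col q q≤)
          (s≤s (s≤s (+-monoˡ-≤ 0 (≤-trans (≤-reflexive (length-map bt A)) A≤)))))))))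
        (≤-reflexive (solve 1 (λ w → w :+ (con 1 :+ (w :+ (con 1 :+ (w :+ (con 2 :+ (w :+ con 0)))))) := con 4 :+ con 4 :* w) refl W))
        where open +-*-Solver

    iteration-run : ∀ {W G s S D} → Sized W G s D →
      i ⊢ mainAt (s ∷ S , D) ⟶[ iterationCost W ] mainAt (expand s S D)
    iteration-run {W} {G} {s@(h , w)} {S} {D} sized = load-phase h w S D columns≤ ▷ go (decide v) refl
      where
      open Sized sized
      v : View
      v = view i s

      rest : ℕ
      rest = suc ((lookupCost W + 1) + (lookupCost W + suc (4 + 4 * W)))

      D-room : ∀ j → j ≤ length D → G + (length D + j) ≤ W
      D-room j j≤ = ≤-trans (+-monoʳ-≤ G (+-monoʳ-≤ (length D) j≤)) values≤

      collected≤ : ∀ t {A} j → j ≤ length D → length A ≤ G + j → length (collectValues t D A) ≤ W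
      collected≤ t j j≤ A≤ = ≤-trans (collectValues-length t j (All.map proj₂ entries≤) A≤) (D-room j j≤)

      last : ∀ t q A b → length q ≤ W → length A ≤ W →
        i ⊢ readyAt (back (h , t , false , b)) s S D q A ⟶[ suc (4 + 4 * W) ]
            mainAt (if b then finish s A S D else launch (t , q) (s ∷ S) D)
      last t q A true  q≤ A≤ = step refl (finish-run h w S D q A columns≤ q≤ A≤)
      last t q A false q≤ A≤ = step refl (launch-run h w S D t q A columns≤ q≤ A≤)

      look : ∀ t m q j A → length A ≤ G + j → j ≤ length D →
        i ⊢ readyAt (scan (h , t , m , false)) s S D q A ⟶[ lookupCost W ]
            readyAt (back (h , t , m , member (t , q) D false)) s S D q (collectValues (t , q) D A)
      look t m q j A A≤ j≤ = Lookup.lookup-run (encodeStack S) (columnsᴸ w ʳ++ []) q h t m j D A entries≤ A≤ (D-room j j≤)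

      Continues : Maybe NAction → Set
      Continues m = i ⊢ readyAt (turnP v) s S D (rewriteBy m w) [] ⟶[ rest ] mainAt (expandBy (outcomeOf s m) s S D)

      finish≤rest : ∀ {n} → n ≤ lookupCost W + suc (4 + 4 * W) → suc n ≤ rest
      finish≤rest n≤ = s≤s (≤-trans n≤ (m≤n+m _ (lookupCost W + 1)))

      reject-or-accept : decide v ≡ nothing → Continues nothing
      reject-or-accept eq = weaken (finish≤rest (≤-trans (n≤1+n _) (m≤n+m _ (lookupCost W))))
        (ends (cong (λ a → config (turnA h) [] (stacksᴾ (encodeStack S) (columnsᴸ w ʳ++ []) [] (columnsᴸ q) [] (encodeTable D) [] a []) [])
                (accumulated (accepting (proj₁ h))))
              (one-step (cong (startLookups h) eq))
        ▷ finish-run h w S D q (carryBits (accepting (proj₁ h))) columns≤ (≤-trans (≤-reflexive (cong length q≡[])) z≤n)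
            (bit≤ (accepting (proj₁ h))))
        where
        q = rewriteBy nothing w
        q≡[] : q ≡ []
        q≡[] = updated-nothing blankColumn blankColumn (w ʳ++ []) []
        accumulated : ∀ b → apply (if b then push (bt (suc zero)) else keep) [] ≡ bitsᴸ (carryBits b)
        accumulated true  = refl
        accumulated false = refl
        bit≤ : ∀ b → length (carryBits b) ≤ W
        bit≤ true  = W≥1
        bit≤ false = z≤n

      explore : ∀ a → decide v ≡ just a → Continues (just a)
      explore a eq = subst (λ q → i ⊢ readyAt (turnP v) s S D q [] ⟶[ rest ] mainAt (expandBy (outcomeOf s (just a)) s S D))
        (sym (updated-just a blankColumn blankColumn (w ʳ++ []) [])) (branching (branches a) refl)
        where
        q : List Column
        q = rewritten a w
        t : Header
        t = target a h
        A₁ : List Bit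
        A₁ = collectValues (t , q) D []
        outcomeIf : Bool → Outcome Conf
        outcomeIf b = if b then double (t , q) (other t , q) else single (t , q)

        branching : ∀ b → branches a ≡ b → i ⊢ readyAt (turnP v) s S D q [] ⟶[ rest ] mainAt (expandBy (outcomeIf (branches a)) s S D)
        branching b b≡ = ends (cong (λ b → mainAt (expandBy (outcomeIf b) s S D)) (sym b≡))
          (step (trans (cong (startLookups h) eq) (cong (λ b → to (scan (h , t , b , false)) []) b≡))
            (lookups b (trans (cong (outcomeOf s) eq) (cong outcomeIf b≡))))
          where
          A₁≤ : length A₁ ≤ W
          A₁≤ = collected≤ (t , q) 0 z≤n z≤n

          second-lookup : ∀ known → length q ≤ W →
            i ⊢ readyAt (back (h , t , true , known)) s S D q A₁ ⟶[ 1 + (lookupCost W + suc (4 + 4 * W)) ]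
                mainAt (if known then (if member (other t , q) D false then finish s (collectValues (other t , q) D A₁) S D
                                       else launch (other t , q) (s ∷ S) D)
                        else launch (t , q) (s ∷ S) D)
          second-lookup false q≤ = step refl (weaken (≤-trans (n≤1+n _) (m≤n+m _ (lookupCost W))) (launch-run h w S D t q A₁ columns≤ q≤ A₁≤))
          -- The accumulator already holds the result of the first lookup, so `length D` additions
          -- have been charged to it.
          second-lookup true  q≤ = step refl (look (other t) false q (length D) A₁
              (≤-trans (collectValues-length (t , q) 0 (All.map proj₂ entries≤) z≤n) (+-monoʳ-≤ G (≤-reflexive (+-identityʳ _)))) ≤-refl
            ▷ last (other t) q _ (member (other t , q) D false) q≤
                (collected≤ (other t , q) (length D) ≤-refl
                  (≤-trans (collectValues-length (t , q) 0 (All.map proj₂ entries≤) z≤n) (+-monoʳ-≤ G (≤-reflexive (+-identityʳ _))))))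

          lookups : ∀ b → outcome i s ≡ outcomeIf b → i ⊢ readyAt (scan (h , t , b , false)) s S D q [] ⟶[ (lookupCost W + 1) + (lookupCost W + suc (4 + 4 * W)) ]
            mainAt (expandBy (outcomeIf b) s S D)
          lookups false o≡ = weaken (+-mono-≤ (m≤m+n (lookupCost W) 1) (m≤n+m _ (lookupCost W)))
            (look t false q 0 [] z≤n z≤n ▷ last t q A₁ (member (t , q) D false) (next≤ (single o≡)) A₁≤)
          lookups true o≡ = weaken (≤-reflexive (sym (+-assoc (lookupCost W) 1 _)))
            (look t true q 0 [] z≤n z≤n ▷ second-lookup (member (t , q) D false) (next≤ (first o≡)))


      go : ∀ m → decide v ≡ m → Continues m
      go nothing  eq = reject-or-accept eq
      go (just a) eq = explore a eq

    output-run : ∀ {W A} D → length (proj₂ startConf) + length A ≤ W + W →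
      i ⊢ mainAt ([] , (startConf , A) ∷ D) ⟶[ 5 + (W + W) ]
          config (out (suc (suc (suc zero)))) [] (stacksᴾ [] [] [] [] [] (encodeTable D) [] [] []) (outputBits A)
    output-run {W} {[]} D l = weaken (+-mono-≤ {4} {5} (n≤1+n 4) z≤n) (step refl (step refl (out₁-run (startColumn ∷ []) ▷
      one-step (trans (cong (maybe′ _ _) (table-noColumn [] D)) (cong (maybe′ _ _) (table-noBit D))))))
    output-run {W} {A@(_ ∷ _)} D l = weaken (≤-trans (+-monoʳ-≤ 4 (n≤1+n _)) (+-monoʳ-≤ 4 (s≤s l)))
      (step refl (step refl (out₁-run (startColumn ∷ []) ▷ step refl (out₂-run A (table-noBit D)))))

    Result : ℕ → Config → Set
    Result n c = ∃ λ A → Val startConf (fromDigits A) × Canonical A × ∃ λ d →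
      i ⊢ c ⟶[ n ] d × choose i d ≡ nothing × output d ≡ outputBits A

    trace-run : ∀ {W n st} → Trace W n st → Result (n * iterationCost W + (5 + (W + W))) (mainAt st)
    trace-run {W} (stop {A} {D} val can l) = A , val , can , _ , output-run {W} D l , refl , refl
    trace-run {W} (next {n} sized tr) = let A , val , can , d , run , stuck , o = trace-run tr in
      A , val , can , d , weaken (≤-reflexive (sym (+-assoc (iterationCost W) _ _))) (iteration-run sized ▷ run) , stuck , o

    boot-run : i ⊢ initial ⟶[ 2 ] mainAt (startConf ∷ [] , (startConf , []) ∷ [])
    boot-run = step refl (step refl done)

    program-correct : ∀ {W n} → Trace W n (startConf ∷ [] , (startConf , []) ∷ []) →
      ∃ λ v → Val startConf v × ∃ λ t → HaltsIn machineᴾ i (initialD machineᴾ) t (binary v) ×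
        t ≤ (2 + (n * iterationCost W + (5 + (W + W)))) + (2 + (n * iterationCost W + (5 + (W + W))))
    program-correct tr =
      let A , val , can , d , run , stuck , o = trace-run tr
          t , halts-in , t≤ = run-initial i (boot-run ▷ run) stuck in
      fromDigits A , val , t , subst (HaltsIn machineᴾ i (initialD machineᴾ) t) (trans o (outputBits-binary can)) halts-in , t≤

-- Bounds

-- A logarithm `suc l` means that `n` exceeds `2 ^ l`. The summand 1 covers logarithm zero,
-- including `n = 0`.
2^⌈log₂⌉ : ∀ n → 2 ^ ⌈log₂ n ⌉ ≤ 1 + 2 * n
2^⌈log₂⌉ n = go ⌈log₂ n ⌉ refl
  where
  go : ∀ l → ⌈log₂ n ⌉ ≡ l → 2 ^ l ≤ 1 + 2 * n
  go zero    e = s≤s z≤n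
  go (suc l) e with n ≤? 2 ^ l
  ... | yes n≤ = contradiction (≤-trans (⌈log₂⌉-mono-≤ n≤) (≤-reflexive (⌈log₂2^n⌉≡n l))) (<⇒≱ (≤-reflexive (sym e)))
  ... | no  n≰ = m≤n⇒m≤1+n (*-monoʳ-≤ 2 (<⇒≤ (≰⇒> n≰)))

n<2^n : ∀ n → n < 2 ^ n
n<2^n zero    = s≤s z≤n
n<2^n (suc n) = ≤-trans (+-mono-≤ (s≤s z≤n) (n<2^n n)) (+-mono-≤ (m^n>0 2 n) (m≤m+n (2 ^ n) 0))

^-distrib-* : ∀ m n k → (m * n) ^ k ≡ m ^ k * n ^ k
^-distrib-* m n zero    = refl
^-distrib-* m n (suc k) = trans (cong (m * n *_) (^-distrib-* m n k))
  (solve 4 (λ a b c d → a :* b :* (c :* d) := a :* c :* (b :* d)) refl m n (m ^ k) (n ^ k))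
  where open +-*-Solver

-- Replacing the base `β` by the larger `2 ^ β` lets the exponents be exchanged. The resulting
-- degree `β` is wasteful but a constant of the machine.
log-power : ∀ β n → β ^ ⌈log₂ n ⌉ ≤ (1 + 2 * n) ^ β
log-power β n = begin
  β ^ l         ≤⟨ ^-monoˡ-≤ l (<⇒≤ (n<2^n β)) ⟩
  (2 ^ β) ^ l   ≡⟨ ^-*-assoc 2 β l ⟩
  2 ^ (β * l)   ≡⟨ cong (2 ^_) (*-comm β l) ⟩
  2 ^ (l * β)   ≡⟨ sym (^-*-assoc 2 l β) ⟩
  (2 ^ l) ^ β   ≤⟨ ^-monoˡ-≤ β (2^⌈log₂⌉ n) ⟩
  (1 + 2 * n) ^ β ∎
  where
  open ≤-Reasoning
  l = ⌈log₂ n ⌉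

-- The polynomial c + (1 + 2X) p(X).
timesOdd : ℕ → List ℕ → List ℕ
timesOdd c []      = c ∷ []
timesOdd c (a ∷ p) = c + a ∷ timesOdd (2 * a) p

timesOdd-eval : ∀ c p n → evalPoly (timesOdd c p) n ≡ c + (1 + 2 * n) * evalPoly p n
timesOdd-eval c []      n = cong (c +_) (trans (*-zeroʳ n) (sym (*-zeroʳ (1 + 2 * n))))
timesOdd-eval c (a ∷ p) n = trans (cong (λ r → c + a + n * r) (timesOdd-eval (2 * a) p n))
  (solve 4 (λ c a n e → c :+ a :+ n :* (con 2 :* a :+ (con 1 :+ con 2 :* n) :* e)
                     := c :+ (con 1 :+ con 2 :* n) :* (a :+ n :* e)) refl c a n (evalPoly p n))
  where open +-*-Solver

oddPower : ℕ → List ℕ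
oddPower zero    = 1 ∷ []
oddPower (suc k) = timesOdd 0 (oddPower k)

oddPower-eval : ∀ k n → evalPoly (oddPower k) n ≡ (1 + 2 * n) ^ k
oddPower-eval zero    n = cong suc (*-zeroʳ n)
oddPower-eval (suc k) n = trans (timesOdd-eval 0 (oddPower k) n) (cong ((1 + 2 * n) *_) (oddPower-eval k n))

-- Computability of the factor that depends on the parameter

addᴿ : Rec 2
addᴿ = precᴿ (projᴿ zero) (compᴿ sucᴿ (projᴿ (suc zero) ∷ []))

addᴱ : ∀ m n → Eval addᴿ (m ∷ n ∷ []) (m + n)
addᴱ zero    n = prec₀ᴱ (projᴱ zero)
addᴱ (suc m) n = precₛᴱ (addᴱ m n) (compᴱ (m + n ∷ []) (λ { zero → projᴱ (suc zero) }) sucᴱ)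

timesᴿ : ℕ → Rec 1
timesᴿ zero    = zeroᴿ
timesᴿ (suc b) = compᴿ addᴿ (projᴿ zero ∷ timesᴿ b ∷ [])

timesᴱ : ∀ b n → Eval (timesᴿ b) (n ∷ []) (b * n)
timesᴱ zero    n = zeroᴱ
timesᴱ (suc b) n = compᴱ (n ∷ b * n ∷ []) (λ { zero → projᴱ zero ; (suc zero) → timesᴱ b n }) (addᴱ n (b * n))

constᴿ : ℕ → Rec 0
constᴿ zero    = zeroᴿ
constᴿ (suc c) = compᴿ sucᴿ (constᴿ c ∷ [])

constᴱ : ∀ c → Eval (constᴿ c) [] c
constᴱ zero    = zeroᴱ
constᴱ (suc c) = compᴱ (c ∷ []) (λ { zero → constᴱ c }) sucᴱ

powerᴿ : ℕ → ℕ → Rec 1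
powerᴿ c b = precᴿ (constᴿ c) (compᴿ (timesᴿ b) (projᴿ (suc zero) ∷ []))

powerᴱ : ∀ c b n → Eval (powerᴿ c b) (n ∷ []) (c * b ^ n)
powerᴱ c b zero    = subst (Eval (powerᴿ c b) (0 ∷ [])) (sym (*-identityʳ c)) (prec₀ᴱ (constᴱ c))
powerᴱ c b (suc n) = subst (Eval (powerᴿ c b) (suc n ∷ []))
  (solve 3 (λ b c p → b :* (c :* p) := c :* (b :* p)) refl b c (b ^ n))
  (precₛᴱ (powerᴱ c b n) (compᴱ (c * b ^ n ∷ []) (λ { zero → projᴱ (suc zero) }) (timesᴱ b (c * b ^ n))))
  where open +-*-Solver

exponential-computable : ∀ c b {f} → Computable f → Computable (λ k → c * b ^ f k)
exponential-computable c b {f} (e , eval) =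
  compᴿ (powerᴿ c b) (e ∷ []) , λ k → compᴱ (f k ∷ []) (λ { zero → eval k }) (powerᴱ c b (f k))

-- Counting the configurations

length-cartesianProductWith : ∀ {A B C : Set} (f : A → B → C) xs ys →
  length (cartesianProductWith f xs ys) ≡ length xs * length ys
length-cartesianProductWith f []       ys = refl
length-cartesianProductWith f (x ∷ xs) ys = trans (length-++ (map (f x) ys))
  (cong₂ _+_ (length-map (f x) ys) (length-cartesianProductWith f xs ys))

module _ {A : Set} where

  elements : Finite A → List A
  elements (n , f) = map (Inverse.from f) (allFin n)

  elements-complete : ∀ (fin : Finite A) a → a ∈ elements fin
  elements-complete (n , f) a = subst (_∈ elements (n , f)) (Inverse.strictlyInverseʳ f a)
    (∈-map⁺ (Inverse.from f) (∈-allFin (Inverse.to f a)))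

  words : List A → ℕ → List (List A)
  words as zero    = [] ∷ []
  words as (suc n) = [] ∷ cartesianProductWith _∷_ as (words as n)

  words-complete : ∀ {as} → (∀ a → a ∈ as) → ∀ {n} w → length w ≤ n → w ∈ words as n
  words-complete all {zero}  []      _       = here refl
  words-complete all {suc n} []      _       = here refl
  words-complete all {suc n} (a ∷ w) (s≤s l) = there (∈-cartesianProductWith⁺ _∷_ (all a) (words-complete all w l))

  words-length : ∀ as n → length (words as n) ≤ (2 + length as) ^ n
  words-length as zero    = ≤-refl
  words-length as (suc n) = begin
    1 + length (cartesianProductWith _∷_ as (words as n)) ≡⟨ cong suc (length-cartesianProductWith _∷_ as (words as n)) ⟩
    1 + length as * length (words as n)                   ≤⟨ +-mono-≤ (m^n>0 (2 + length as) n) (*-monoʳ-≤ (length as) (words-length as n)) ⟩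
    (1 + length as) * (2 + length as) ^ n                 ≤⟨ *-monoˡ-≤ ((2 + length as) ^ n) (n≤1+n (1 + length as)) ⟩
    (2 + length as) ^ suc n                               ∎
    where
    open ≤-Reasoning

-- Expanded, the cost is `14 W² + 21 W + 12`, and `14 + 21 + 12 = 47`. The substitution of `1 + y`
-- for `W` turns the slack into a polynomial without negative coefficients.
iterationCost≤ : ∀ W → 1 ≤ W → iterationCost W ≤ 47 * (W * W)
iterationCost≤ (suc y) _ = ≤-trans (m≤m+n _ (45 * y + 33 * (y * y))) (≤-reflexive
  (solve 1 (λ y → let w = con 1 :+ y
                      l = w :* (con 6 :+ con 5 :* w) :+ (con 1 :+ w :* (con 1 :+ (w :+ w)))
                  in ((con 3 :+ con 3 :* w) :+ (con 1 :+ ((l :+ con 1) :+ (l :+ (con 1 :+ (con 4 :+ con 4 :* w))))))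
                     :+ (con 45 :* y :+ con 33 :* (y :* y)) := con 47 :* (w :* w)) refl y))
  where open +-*-Solver

-- With `Y = X W²`, the iterations cost at most `2 · 47 Y`; the remaining `7 + 2 W` is at most
-- `9 Y`, giving `103 Y` for `r`. Two machine steps per stack step and `W = 14 X²` give
-- `40376 = 2 · 103 · 14²`.
time-bound : ∀ X {n t} → 1 ≤ X → n ≤ X + X →
  let W = 14 * (X * X) ; r = 2 + (n * iterationCost W + (5 + (W + W))) in t ≤ r + r → t ≤ 40376 * X ^ 5
time-bound X {n} {t} X≥1 n≤ t≤ = begin
  t                                 ≤⟨ t≤ ⟩
  r + r                             ≤⟨ +-mono-≤ r≤ r≤ ⟩
  103 * Y + 103 * Y                 ≡⟨ solve 1 (λ x → let w = con 14 :* (x :* x) ; y = x :* (w :* w) in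
                                         con 103 :* y :+ con 103 :* y := con 40376 :* (x :* (x :* (x :* (x :* (x :* con 1)))))) refl X ⟩
  40376 * X ^ 5                     ∎
  where
  open ≤-Reasoning
  open +-*-Solver
  W = 14 * (X * X)
  Y = X * (W * W)
  r = 2 + (n * iterationCost W + (5 + (W + W)))

  W≥1 : 1 ≤ W
  W≥1 = *-mono-≤ {1} {14} (s≤s z≤n) (*-mono-≤ X≥1 X≥1)

  W≤Y : W ≤ Y
  W≤Y = ≤-trans (≤-reflexive (sym (*-identityˡ W))) (≤-trans (*-monoˡ-≤ W W≥1)
    (≤-trans (≤-reflexive (sym (*-identityˡ _))) (*-monoˡ-≤ (W * W) X≥1)))

  r≤ : r ≤ 103 * Y
  r≤ = begin
    2 + (n * iterationCost W + (5 + (W + W)))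
      ≤⟨ +-monoʳ-≤ 2 (+-mono-≤ (*-mono-≤ n≤ (iterationCost≤ W W≥1)) (+-monoʳ-≤ 5 (+-mono-≤ W≤Y W≤Y))) ⟩
    2 + ((X + X) * (47 * (W * W)) + (5 + (Y + Y)))
      ≡⟨ solve 2 (λ x w → let y = x :* (w :* w) in
           con 2 :+ ((x :+ x) :* (con 47 :* (w :* w)) :+ (con 5 :+ (y :+ y))) := con 7 :+ con 96 :* y) refl X W ⟩
    7 + 96 * Y
      ≤⟨ +-monoˡ-≤ (96 * Y) (*-monoʳ-≤ 7 (≤-trans W≥1 W≤Y)) ⟩
    7 * Y + 96 * Y
      ≡⟨ sym (*-distribʳ-+ Y 7 96) ⟩
    103 * Y ∎

theorem9 : #paraβ-L ⊆ FFPT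
theorem9 {F} (N , (f , f-computable , a , space≤) , (g , _ , bits≤) , once , counts) =
  machineᴾ , (λ k → c * β ^ f k) , exponential-computable c β f-computable , oddPower β , computes
  where
  open Program N once
  open Columns N

  columns : List Column
  columns = elements finite-Column

  headers : List Header
  headers = elements finite-Header

  b β c : ℕ
  -- The summand 2 makes `b` at least 2, from which `B≤W` follows. The 5 in `β` is the exponent of
  -- `X` in `time-bound`.
  b = 2 + length columns
  β = b ^ (a * 5)
  c = 40376 * suc (length headers) ^ 5

  computes : ∀ x k → ∃ λ t → HaltsIn machineᴾ (x , k) (initialD machineᴾ) t (binary (F (x , k))) ×
           t ≤ c * β ^ f k * evalPoly (oddPower β) (length x)
  computes x k =
    let n , n≤ , tr = trace (U + U) start-progress
        v , val , t , halts-in , t≤ = program-correct tr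
        -- Both `Fin v` and `Fin (F (x , k))` are in bijection with the accepting paths from the
        -- initial configuration.
        v≡F = ↔⇒≡ (counts (x , k) ↔-∘ ↔-sym (val _ describes-start))
    in t , subst (λ v → HaltsIn machineᴾ (x , k) (initialD machineᴾ) t (binary v)) v≡F halts-in ,
       ≤-trans (time-bound X X≥1 (≤-trans n≤ (+-mono-≤ U≤X U≤X)) t≤) X-bound
    where
    open Run (x , k)
    open Search N once (x , k)
    open Bounded (g k * ⌈log₂ length x ⌉) (bits≤ x k)

    B X W : ℕ
    B = a * (⌈log₂ length x ⌉ + f k)
    X = suc (length headers) * b ^ B
    -- Starting from one bit, `2 X` iterations with at most `2 (1 + 2 X)` additions each lead to at
    -- most `1 + 4 X + 8 X²` bits, which `14 X²` covers.
    W = 14 * (X * X)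

    universe : List Conf
    universe = cartesianProduct headers (words columns B)

    short : ∀ {s} → ReachableConf s → length (proj₂ s) ≤ B
    short (c , r , d) = ≤-trans (represents-length {c = NConfig.base c} (Describes.columns d)) (space≤ x k c r)

    covers : ∀ {s} → ReachableConf s → s ∈ universe
    covers {h , w} r = ∈-cartesianProduct⁺ (elements-complete finite-Header h)
      (words-complete (elements-complete finite-Column) w (short r))

    X≥1 : 1 ≤ X
    X≥1 = *-mono-≤ {1} {suc (length headers)} (s≤s z≤n) (m^n>0 b B)

    X≤X² : X ≤ X * X
    X≤X² = ≤-trans (≤-reflexive (sym (*-identityˡ X))) (*-monoˡ-≤ X X≥1)

    X²≤W : X * X ≤ W
    X²≤W = m≤m+n (X * X) _

    B≤W : B ≤ W
    B≤W = ≤-trans (<⇒≤ (n<2^n B)) (≤-trans (^-monoˡ-≤ B (m≤m+n 2 _))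
      (≤-trans (m≤m+n (b ^ B) _) (≤-trans X≤X² X²≤W)))

    M : ℕ
    M = 1 + (length universe + length universe)

    open SearchIn universe covers W M (λ r → ≤-trans (short r) B≤W)

    U≤X : U ≤ X
    U≤X = ≤-trans (≤-reflexive (length-cartesianProductWith _,_ headers (words columns B)))
      (*-mono-≤ (n≤1+n (length headers)) (words-length columns B))

    X-bound : 40376 * X ^ 5 ≤ c * β ^ f k * evalPoly (oddPower β) (length x)
    X-bound = begin
      40376 * X ^ 5
        ≡⟨ cong (40376 *_) (^-distrib-* (suc (length headers)) (b ^ B) 5) ⟩
      40376 * (suc (length headers) ^ 5 * (b ^ B) ^ 5)
        ≡⟨ sym (*-assoc 40376 (suc (length headers) ^ 5) ((b ^ B) ^ 5)) ⟩
      c * (b ^ B) ^ 5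
        ≡⟨ cong (c *_) b^B^5 ⟩
      c * (β ^ f k * β ^ ⌈log₂ length x ⌉)
        ≡⟨ sym (*-assoc c (β ^ f k) _) ⟩
      c * β ^ f k * β ^ ⌈log₂ length x ⌉
        ≤⟨ *-monoʳ-≤ (c * β ^ f k) (log-power β (length x)) ⟩
      c * β ^ f k * (1 + 2 * length x) ^ β
        ≡⟨ cong (c * β ^ f k *_) (sym (oddPower-eval β (length x))) ⟩
      c * β ^ f k * evalPoly (oddPower β) (length x) ∎
      where
      open ≤-Reasoning
      b^B^5 : (b ^ B) ^ 5 ≡ β ^ f k * β ^ ⌈log₂ length x ⌉
      b^B^5 = trans (^-*-assoc b B 5) (trans (cong (b ^_) (exponent a ⌈log₂ length x ⌉ (f k)))
        (trans (sym (^-*-assoc b (a * 5) (f k + ⌈log₂ length x ⌉))) (^-distribˡ-+-* β (f k) ⌈log₂ length x ⌉)))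
        where
        open +-*-Solver
        exponent : ∀ a l m → a * (l + m) * 5 ≡ a * 5 * (m + l)
        exponent = solve 3 (λ a l m → a :* (l :+ m) :* con 5 := a :* con 5 :* (m :+ l)) refl

    start-progress : Progress (U + U) (startConf ∷ []) ((startConf , []) ∷ []) (startConf ∷ [])
    start-progress = record
      { invariant = start-invariant
      ; bottom    = [] , refl
      ; fuel      = ≤-trans (n≤1+n _) (≤-reflexive (+-comm 2 (U + U)))
      ; table≤M   = ≤-refl
      -- One bit holds the count 1 of an accepting halt, the only nonzero value that does not arise
      -- by addition.
      ; G         = 1
      ; values    = z≤n ∷ []
      ; keys      = ≤-trans X≥1 (≤-trans X≤X² X²≤W) ∷ []
      ; positive  = s≤s z≤n
      ; room      = begin
          1 + (U + U) * (M + M)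
            ≤⟨ +-monoʳ-≤ 1 (*-mono-≤ (+-mono-≤ U≤X U≤X) (+-mono-≤ M≤ M≤)) ⟩
          1 + (X + X) * ((1 + (X + X)) + (1 + (X + X)))
            ≡⟨ solve 1 (λ x → con 1 :+ (x :+ x) :* ((con 1 :+ (x :+ x)) :+ (con 1 :+ (x :+ x)))
                          := con 1 :+ con 4 :* x :+ con 8 :* (x :* x)) refl X ⟩
          1 + 4 * X + 8 * (X * X)
            ≤⟨ +-monoˡ-≤ (8 * (X * X)) (+-mono-≤ (≤-trans X≥1 X≤X²) (*-monoʳ-≤ 4 X≤X²)) ⟩
          X * X + 4 * (X * X) + 8 * (X * X)
            ≤⟨ m≤m+n _ (X * X) ⟩
          X * X + 4 * (X * X) + 8 * (X * X) + X * X
            ≡⟨ solve 1 (λ y → y :+ con 4 :* y :+ con 8 :* y :+ y := con 14 :* y) refl (X * X) ⟩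
          W ∎ }
      where
      open ≤-Reasoning
      open +-*-Solver
      M≤ : M ≤ 1 + (X + X)
      M≤ = s≤s (+-mono-≤ U≤X U≤X)
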